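{- Let $q$ be a prime power, let $m\ge1$, $s\ge1$, $u\ge0$ and $r\ge1$ be integers, and let $\mathbf{e}=(e_1,\dots,e_s)\in\mathbb{N}^s$. If there exists a digital $(u,m,\mathbf{e},s)$-net over $\mathbb{F}_{q^r}$, then there exists a digital $((r-1)m+u,\,rm,\,\mathbf{f},\,rs)$-net over $\mathbb{F}_q$, where $\mathbf{f}=(e_1,\dots,e_1,e_2,\dots,e_2,\dots,e_s,\dots,e_s)\in\mathbb{N}^{rs}$ with each $e_i$ repeated $r$ times.
   Context: $\mathbb{N}$ denotes the positive integers, $\lambda_s$ Lebesgue measure. An elementary interval in base $b$ is $J=\prod_{i=1}^s[a_ib^{ -d_i},(a_i+1)b^{ -d_i})$ with integers $d_i\ge0$, $0\le a_i<b^{d_i}$. For integers $0\le u\le m$ and $\mathbf{e}=(e_1,\dots,e_s)\in\mathbb{N}^s$, a set of $b^m$ points in $[0,1)^s$ is a $(u,m,\mathbf{e},s)$-net in base $b$ if every elementary interval $J$ in base $b$ with $\lambda_s(J)\ge b^{u-m}$ and $e_i\mid d_i$ for all $i$ contains exactly $b^m\lambda_s(J)$ of the points. Digital net over a finite field $\mathbb{F}_Q$ ($Q$ a prime power): given $m\times m$ generating matrices $C_1,\dots,C_s$ over $\mathbb{F}_Q$, bijections $\eta_r:Z_Q\to\mathbb{F}_Q$ ($0\le r<m$) and $\kappa_{i,j}:\mathbb{F}_Q\to Z_Q$ where $Z_Q=\{0,\dots,Q-1\}$, for $0\le n<Q^m$ with base-$Q$ digits $n_0,\dots,n_{m-1}$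 put $(y^{(i)}_{n,1},\dots,y^{(i)}_{n,m})^\top=C_i(\eta_0(n_0),\dots,\eta_{m-1}(n_{m-1}))^\top$, $x_n^{(i)}=\sum_{j=1}^m\kappa_{i,j}(y^{(i)}_{n,j})Q^{ -j}$, $\mathbf{x}_n=(x_n^{(1)},\dots,x_n^{(s)})$. The resulting point set is a digital net over $\mathbb{F}_Q$; it is a digital $(u,m,\mathbf{e},s)$-net over $\mathbb{F}_Q$ if it is a $(u,m,\mathbf{e},s)$-net in base $Q$. -}

module Defs where

open import Level using (0ℓ)
open import Data.Nat using (ℕ; zero; suc; _+_; _*_; _∸_; _^_; _≤_; _<_; NonZero; _≤ᵇ_; _<ᵇ_)
open import Data.Nat.DivMod using (_/_; _mod_)
open import Data.Nat.Divisibility using (_∣_)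
open import Data.Nat.Primality using (Prime)
open import Data.Fin using (Fin; toℕ; quotient)
open import Data.Bool using (Bool; true; false; _∧_)
open import Data.Product using (Σ; ∃; _×_; _,_; proj₁)
open import Function.Bundles using (_⤖_; Bijection)
open import Relation.Nullary using (¬_)
open import Relation.Binary.PropositionalEquality using (_≡_; _≢_; refl)
open import Algebra.Structures using (IsCommutativeRing)

IsPrimePower : ℕ → Set
IsPrimePower q = Σ ℕ λ p → Σ ℕ λ k → Prime p × 1 ≤ k × q ≡ p ^ k

record FiniteField (Q : ℕ) : Set₁ where
  field
    Carrier : Set
    _+F_ _*F_ : Carrier → Carrier → Carrier
    -F_ : Carrier → Carrier
    0F 1F : Carrier
    isCommutativeRing : IsCommutativeRing _≡_ _+F_ _*F_ -F_ 0F 1F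
    0≢1 : 0F ≢ 1F
    inverse : (x : Carrier) → x ≢ 0F → Σ Carrier λ y → x *F y ≡ 1F
    card : Fin Q ⤖ Carrier

ff-nonZero : ∀ {Q} → FiniteField Q → NonZero Q
ff-nonZero {zero} K with Bijection.surjective (FiniteField.card K) (FiniteField.0F K)
... | () , _
ff-nonZero {suc Q} K = _

count : ℕ → (ℕ → Bool) → ℕ
count zero P = 0
count (suc N) P with P N
... | true = suc (count N P)
... | false = count N P

module _ {Q : ℕ} (K : FiniteField Q) where
  open FiniteField K
  ΣF : (m : ℕ) → (Fin m → Carrier) → Carrier
  ΣF zero f = 0F
  ΣF (suc m) f = f Fin.zero +F ΣF m (λ k → f (Fin.suc k))
    where import Data.Fin as Fin

Σℕ : (s : ℕ) → (Fin s → ℕ) → ℕ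
Σℕ zero f = 0
Σℕ (suc s) f = f Data.Fin.zero + Σℕ s (λ k → f (Data.Fin.suc k))

digit : (Q : ℕ) → .{{NonZero Q}} → ℕ → ℕ → Fin Q
digit Q k n = (n / (Q ^ k)) {{nz}} mod Q
  where
  nz : NonZero (Q ^ k)
  nz = m^n≢0 Q k
    where open import Data.Nat.Properties using (m^n≢0)

record DigitalNetData {Q : ℕ} (K : FiniteField Q) (m s : ℕ) : Set where
  open FiniteField K
  field
    C : Fin s → Fin m → Fin m → Carrier     -- C i : row index j, column index k
    η : Fin m → (Fin Q ⤖ Carrier)
    κ : Fin s → Fin m → (Carrier ⤖ Fin Q)

-- Numerator X of the i-th coordinate of the n-th point: x_n^(i) = X / Q^m,
-- X = Σ_{j=1}^m κ_{i,j}(y_{n,j}^(i)) Q^(m-j)   (j is 0-indexed below).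
pointNum : ∀ {Q m s} (K : FiniteField Q) → DigitalNetData K m s → ℕ → Fin s → ℕ
pointNum {Q} {m} {s} K D n i = Σℕ m λ j →
    toℕ (Bijection.to (κ i j) (y j)) * Q ^ (m ∸ suc (toℕ j))
  where
  open FiniteField K
  open DigitalNetData D
  instance _ = ff-nonZero K
  v : Fin m → Carrier
  v r = Bijection.to (η r) (digit Q (toℕ r) n)
  y : Fin m → Carrier
  y j = ΣF K m λ r → C i j r *F v r

-- x = X/b^m lies in [a b^{-d}, (a+1) b^{-d})  (for d ≤ m)
inInterval : (b m d a X : ℕ) → Bool
inInterval b m d a X = (a * b ^ (m ∸ d) ≤ᵇ X) ∧ (X <ᵇ (suc a) * b ^ (m ∸ d))

-- The point family x_0..x_{b^m-1} (given by numerators X n i, x = X/b^m) is a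
-- (u,m,e,s)-net in base b.  An elementary interval J with parameters d, a has
-- λ(J) = b^{-Σd}, so λ(J) ≥ b^{u-m} ⟺ Σd + u ≤ m, and b^m λ(J) = b^{m-Σd}.
IsNet : (b u m s : ℕ) → (e : Fin s → ℕ) → (X : ℕ → Fin s → ℕ) → Set
IsNet b u m s e X =
  u ≤ m ×
  ((d a : Fin s → ℕ) → (∀ i → a i < b ^ d i) → (∀ i → e i ∣ d i) → Σℕ s d + u ≤ m →
    count (b ^ m) (λ n → allFin s (λ i → inInterval b m (d i) (a i) (X n i)))
      ≡ b ^ (m ∸ Σℕ s d))
  where
  allFin : (s : ℕ) → (Fin s → Bool) → Bool
  allFin zero f = true
  allFin (suc s) f = f Data.Fin.zero ∧ allFin s (λ k → f (Data.Fin.suc k))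

DigitalNetExists : ∀ {Q s} → FiniteField Q → (u m : ℕ) → (e : Fin s → ℕ) → Set
DigitalNetExists {Q} {s} K u m e =
  Σ (DigitalNetData K m s) λ D → IsNet Q u m s e (pointNum K D)

-- f = (e_1,…,e_1, e_2,…,e_2, …, e_s,…,e_s), each repeated r times (index i*r + j ↦ e_i)
repeatEach : ∀ {s} (r : ℕ) → (Fin s → ℕ) → Fin (s * r) → ℕ
repeatEach r e k = e (quotient r k)

{-# OPTIONS --safe #-}
module Submission where

-- Write Q = q^r. The net property of a digital net says that for all d with e_i ∣ d_i and
-- Σ d_i + u ≤ m the outputs of the rows C_i,j with j < d_i can be prescribed arbitrarily: a
-- surjective additive map has fibres of equal size, and a point lies in an elementary interval
-- exactly when its leading digits are prescribed.
--
-- F embeds into K: starting with the graph of the identification of the prime fields, adjoin the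
-- elements α of F one by one. The minimal polynomial of α divides X^Q - X, so its image over K has
-- a root β, and the graph extends by α ↦ β.
--
-- Choose an F-basis of K and identify K^m with F^(rm). Each row C_i,j gives r functionals over F, the
-- coordinates of v ↦ ⟨C_i,j , v⟩, one for each of the r matrices replacing C_i. Prescribing the first
-- d_i,h digits for each h only involves rows j < D_i = max_h d_i,h of C_i, and Σ D_i ≤ Σ d_i,h.

-- The embedding is shaped by constructivity. Membership in a graph is not assumed decidable, so a
-- minimal polynomial is available only under double negation. The negation is removed at the end,
-- because there are finitely many tables of maps from F to K and it is decidable whether one of
-- them is a homomorphism. A graph is a subring of F × K. A polynomial with coefficients in it is at
-- once a polynomial over a subfield of F and its image over K, and evaluation at (α , β) performs
-- both computations. The coefficients of X^Q - X lie in every graph, and since Q = q^r this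
-- polynomial vanishes on all of F as well as on all of K. The constant (r-1)m + u comes from
-- comparing two conditions: Σd + (r-1)m + u ≤ rm says Σd + u ≤ m, which is what the given net
-- needs. In particular no d_i,h exceeds m, so the m rows supplied by each C_i are enough.

open import Defs
open import Algebra.Bundles using (CommutativeMonoid; CommutativeRing)
import Algebra.Construct.DirectProduct as DirectProduct
import Algebra.Properties.CommutativeMonoid.Sum as CMSum
import Algebra.Properties.Monoid.Mult as Mult
import Algebra.Properties.Ring as RingProperties
import Algebra.Properties.Semiring.Mult as SemiringMult
import Algebra.Properties.Semiring.Sum as SemiringSum
import Algebra.Solver.Ring.NaturalCoefficients.Default
open import Data.Bool using (Bool; true; false; _∧_; if_then_else_)
open import Data.Bool.Properties using (T-∧; T-≡)
open import Data.Fin as Fin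
  using (Fin; zero; suc; toℕ; fromℕ<; inject≤; combine; quotient; remainder; _↑ˡ_; _↑ʳ_)
import Data.Fin.Properties as Finₚ
open import Data.Nat as ℕ using (ℕ; zero; suc; z≤n; s≤s; NonZero; _∸_; _≤_; _<_; _⊔_)
open import Data.Nat.Coprimality using (coprime-Bézout)
open import Data.Nat.Divisibility using (_∣_; divides; _∣?_; _∣0; n∣m*n)
open import Data.Nat.DivMod using (_/_; _%_; _mod_; n/1≡n; m*n/n≡m; m<n⇒m/n≡0; m<n⇒m%n≡m; m%n<n; m<n*o⇒m/o<n;
  m≡m%n+[m/n]*n; [m+kn]%n≡m%n; m/n/o≡m/[n*o]; +-distrib-/-∣ʳ)
open import Data.Nat.GCD using (module Bézout)
open import Data.Nat.Induction using (<-rec)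
open import Data.Nat.Primality using (Prime; ¬prime[0]; prime⇒irreducible)
import Data.Nat.Properties as ℕₚ
open import Data.Product using (Σ; _×_; _,_; proj₁; proj₂)
open import Data.Sum using (_⊎_; inj₁; inj₂; [_,_]′)
open import Data.Vec as Vec using (Vec; []; _∷_; _++_)
import Data.Vec.Properties as Vecₚ
open import Data.Vec.Relation.Unary.All as All using (All; []; _∷_)
import Data.Vec.Relation.Unary.All.Properties as Allₚ
open import Function using (_∘_; id)
open import Function.Bundles using (_↔_; Inverse; mk↔ₛ′; Bijection; Equivalence)
open import Function.Construct.Composition using (_↔-∘_)
open import Function.Construct.Symmetry using (↔-sym)
open import Function.Properties.Bijection using (⤖⇒↔; sym-≡)
open import Level using (0ℓ)
open import Relation.Binary.Definitions using (DecidableEquality)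
open import Relation.Binary.PropositionalEquality as ≡
  using (_≡_; _≢_; refl; cong; cong₂; subst; sym; trans; module ≡-Reasoning)
open import Relation.Nullary using (¬_; ¬?; Dec; yes; no; does; contradiction)
open import Relation.Nullary.Decidable using (map′; _×-dec_; dec-true; dec-false; decidable-stable)

-- Finite fields

module _ {c ℓ} (M : CommutativeMonoid c ℓ) where
  open CommutativeMonoid M renaming (refl to ≈-refl; sym to ≈-sym; trans to ≈-trans)
  open CMSum M

  -- Two enumerations of a finite type differ by a permutation of `Fin n`. Translating, scaling and
  -- replacing digit bijections under a sum or product are all instances.
  sum-↔ : ∀ {n} {A : Set} (f : A → Carrier) (α β : Fin n ↔ A) →
    sum (f ∘ Inverse.to α) ≈ sum (f ∘ Inverse.to β)
  sum-↔ f α β = ≈-trans (sum-permute (f ∘ Inverse.to α) (↔-sym α ↔-∘ β))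
    (reflexive (sum-cong-≗ λ i → cong f (Inverse.strictlyInverseˡ α (Inverse.to β i))))

  sum-zero : ∀ {n} (f : Fin n → Carrier) → (∀ j → f j ≈ ε) → sum f ≈ ε
  sum-zero {zero}  f f≈ε = ≈-refl
  sum-zero {suc n} f f≈ε = ≈-trans (∙-cong (f≈ε zero) (sum-zero (f ∘ suc) (f≈ε ∘ suc))) (identityˡ ε)

  sum-single : ∀ {n} (i : Fin n) (f : Fin n → Carrier) →
    (∀ j → j ≢ i → f j ≈ ε) → sum f ≈ f i
  sum-single zero    f f≈ε =
    ≈-trans (∙-congˡ (sum-zero (f ∘ suc) λ j → f≈ε (suc j) λ ())) (identityʳ _)
  sum-single (suc i) f f≈ε = ≈-trans
    (∙-cong (f≈ε zero λ ()) (sum-single i (f ∘ suc) λ j j≢i → f≈ε (suc j) (j≢i ∘ Finₚ.suc-injective)))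
    (identityˡ _)

-- Exhaustive search over finite types

Exhaustible : Set → Set₁
Exhaustible A = (P : A → Set) → (∀ a → Dec (P a)) → Dec (Σ A P)

exhaustible-↔ : ∀ {n A} → Fin n ↔ A → Exhaustible A
exhaustible-↔ α P P? = map′
  (λ (i , p) → Inverse.to α i , p)
  (λ (a , p) → Inverse.from α a , subst P (sym (Inverse.strictlyInverseˡ α a)) p)
  (Finₚ.any? (λ i → P? (Inverse.to α i)))

exhaustible-Vec : ∀ {A} → Exhaustible A → ∀ n → Exhaustible (Vec A n)
exhaustible-Vec A? zero    P P? = map′ ([] ,_) (λ { ([] , p) → p }) (P? [])
exhaustible-Vec A? (suc n) P P? = map′
  (λ (a , v , p) → a ∷ v , p) (λ { (a ∷ v , p) → a , v , p })
  (A? _ λ a → exhaustible-Vec A? n _ λ v → P? (a ∷ v))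

exhaustible-∀ : ∀ {A} → Exhaustible A → (P : A → Set) → (∀ a → Dec (P a)) → Dec (∀ a → P a)
exhaustible-∀ A? P P? with A? (λ a → ¬ P a) (λ a → ¬? (P? a))
... | yes (a , ¬p) = no λ p → ¬p (p a)
... | no ¬∃        = yes λ a → decidable-stable (P? a) λ ¬p → ¬∃ (a , ¬p)

module Field {Q : ℕ} (K : FiniteField Q) where
  open FiniteField K using (Carrier; isCommutativeRing; 0≢1; inverse; card) public

  ring : CommutativeRing 0ℓ 0ℓ
  ring = record { isCommutativeRing = isCommutativeRing }

  open CommutativeRing ring using (_+_; _*_; -_; 0#; 1#; +-comm; +-assoc; +-identityˡ; +-identityʳ; -‿inverseˡ; -‿inverseʳ;
    *-comm; *-assoc; *-identityˡ; *-identityʳ; distribˡ; zeroˡ; zeroʳ; +-commutativeMonoid; *-commutativeMonoid; semiring) public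
  open RingProperties (CommutativeRing.ring ring) public using (+-cancelˡ; +-cancelʳ; +-inverseˡ-unique; -‿involutive; -‿distribʳ-*)

  module Solver = Algebra.Solver.Ring.NaturalCoefficients.Default (CommutativeRing.commutativeSemiring ring)

  index : Fin Q ↔ Carrier
  index = ⤖⇒↔ card

  infix 4 _≟_
  abstract
    _≟_ : DecidableEquality Carrier
    x ≟ y = map′ (λ eq → trans (sym (to∘from x)) (trans (cong to eq) (to∘from y))) (cong from) (from x Finₚ.≟ from y)
      where open Inverse index using (to; from) renaming (strictlyInverseˡ to to∘from)

  exhaustible : Exhaustible Carrier
  exhaustible = exhaustible-↔ index

  *-swap : ∀ x y z → x * (y * z) ≡ y * (x * z)
  *-swap = Solver.solve 3 (λ x y z → x :* (y :* z) := y :* (x :* z)) refl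
    where open Solver using (_:*_; _:=_)

  *-cancelˡ : ∀ x {y z} → x ≢ 0# → x * y ≡ x * z → y ≡ z
  *-cancelˡ x {y} {z} x≢0 eq with x⁻¹ , x*x⁻¹≡1 ← inverse x x≢0 = begin
    y                ≡⟨ *-identityˡ y ⟨
    1# * y           ≡⟨ cong (_* y) x*x⁻¹≡1 ⟨
    (x * x⁻¹) * y    ≡⟨ trans (*-assoc x x⁻¹ y) (*-swap x x⁻¹ y) ⟩
    x⁻¹ * (x * y)    ≡⟨ cong (x⁻¹ *_) eq ⟩
    x⁻¹ * (x * z)    ≡⟨ trans (*-assoc x x⁻¹ z) (*-swap x x⁻¹ z) ⟨
    (x * x⁻¹) * z    ≡⟨ cong (_* z) x*x⁻¹≡1 ⟩
    1# * z           ≡⟨ *-identityˡ z ⟩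
    z                ∎
    where open ≡-Reasoning

  x*y≢0 : ∀ {x y} → x ≢ 0# → y ≢ 0# → x * y ≢ 0#
  x*y≢0 {x} {y} x≢0 y≢0 xy≡0 = y≢0 (*-cancelˡ x x≢0 (trans xy≡0 (sym (zeroʳ x))))

  x*y≡0⇒y≡0 : ∀ {x y} → x ≢ 0# → x * y ≡ 0# → y ≡ 0#
  x*y≡0⇒y≡0 {x} x≢0 xy≡0 = *-cancelˡ x x≢0 (trans xy≡0 (sym (zeroʳ x)))

  x-y≡0⇒x≡y : ∀ {x y} → x + - y ≡ 0# → x ≡ y
  x-y≡0⇒x≡y {x} {y} eq = trans (+-inverseˡ-unique x (- y) eq) (-‿involutive y)

  translate : Carrier → Carrier ↔ Carrier
  translate a = mk↔ₛ′ (_+ a) (_+ (- a))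
    (λ x → trans (+-assoc x (- a) a) (trans (cong (x +_) (-‿inverseˡ a)) (+-identityʳ x)))
    (λ x → trans (+-assoc x a (- a)) (trans (cong (x +_) (-‿inverseʳ a)) (+-identityʳ x)))

  scale : ∀ a → a ≢ 0# → Carrier ↔ Carrier
  scale a a≢0 with a⁻¹ , a*a⁻¹≡1 ← inverse a a≢0 = mk↔ₛ′ (a *_) (a⁻¹ *_)
    (λ x → trans (sym (*-assoc a a⁻¹ x)) (trans (cong (_* x) a*a⁻¹≡1) (*-identityˡ x)))
    (λ x → trans (sym (*-assoc a⁻¹ a x)) (trans (cong (_* x) (trans (*-comm a⁻¹ a) a*a⁻¹≡1)) (*-identityˡ x)))

  open Mult (CommutativeRing.+-monoid ring) public using () renaming (_×_ to _·_)
  open Mult (CommutativeRing.*-monoid ring) using () renaming (_×_ to power)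

  infixr 8 _^_
  _^_ : Carrier → ℕ → Carrier
  x ^ n = power n x

  -- Translation by 1 permutes the field, so the sum of all elements absorbs Q·1.
  card·1≡0 : Q · 1# ≡ 0#
  card·1≡0 = +-cancelˡ (sum id′) _ _ (begin
    sum id′ + Q · 1#                  ≡⟨ cong (sum id′ +_) (sum-replicate Q) ⟨
    sum id′ + sum {Q} (λ _ → 1#)      ≡⟨ ∑-distrib-+ {Q} id′ (λ _ → 1#) ⟨
    sum (λ i → id′ i + 1#)            ≡⟨ sum-↔ +-commutativeMonoid id (translate 1# ↔-∘ index) index ⟩
    sum id′                           ≡⟨ +-identityʳ _ ⟨
    sum id′ + 0#                      ∎)
    where
    open ≡-Reasoning
    open CMSum +-commutativeMonoid using (sum; sum-replicate; ∑-distrib-+)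
    id′ : Fin Q → Carrier
    id′ = Inverse.to index

  -- Scaling by x permutes the nonzero elements, so their product P satisfies x^(Q-1) P = P;
  -- the product is taken over all elements, with the factor at 0 replaced.
  x^card≡x : ∀ x → x ^ Q ≡ x
  x^card≡x x with x ≟ 0#
  ... | yes refl = zero^ Q {{ff-nonZero K}}
    where
    zero^ : ∀ n → .{{ℕ.NonZero n}} → 0# ^ n ≡ 0#
    zero^ (suc n) = zeroˡ _
  ... | no x≢0 = sym (begin
    x                          ≡⟨ prod-only ⟨
    prod (only ∘ to)           ≡⟨ *-identityˡ _ ⟨
    1# * prod (only ∘ to)      ≡⟨ cong (_* prod (only ∘ to)) prod-rest ⟨
    prod (rest ∘ to) * prod (only ∘ to) ≡⟨ ∑-distrib-+ (rest ∘ to) (only ∘ to) ⟨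
    prod (λ i → rest (to i) * only (to i)) ≡⟨ sum-cong-≗ (λ i → rest*only (to i)) ⟩
    prod {Q} (λ _ → x)         ≡⟨ sum-replicate Q ⟩
    x ^ Q                      ∎)
    where
    open ≡-Reasoning
    open CMSum *-commutativeMonoid using (sum-replicate; ∑-distrib-+; sum-cong-≗) renaming (sum to prod)
    open Inverse index using (to; from; strictlyInverseˡ; strictlyInverseʳ)
    -- `rest` contributes x once for every nonzero element and `only` supplies the one x still
    -- missing at 0, so their pointwise product is the constant x.
    unit rest only : Carrier → Carrier
    unit y = if does (y ≟ 0#) then 1# else y
    rest y = if does (y ≟ 0#) then 1# else x
    only y = if does (y ≟ 0#) then x else 1#

    rest*only : ∀ y → rest y * only y ≡ x
    rest*only y with y ≟ 0#
    ... | yes _ = *-identityˡ x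
    ... | no _  = *-identityʳ x

    only-0 : only 0# ≡ x
    only-0 with 0# ≟ 0#
    ... | yes _ = refl
    ... | no 0≢0 = contradiction refl 0≢0

    only-≢0 : ∀ y → y ≢ 0# → only y ≡ 1#
    only-≢0 y y≢0 with y ≟ 0#
    ... | yes y≡0 = contradiction y≡0 y≢0
    ... | no _ = refl

    prod-only : prod (only ∘ to) ≡ x
    prod-only = trans
      (sum-single *-commutativeMonoid (from 0#) (only ∘ to)
        (λ j j≢ → only-≢0 (to j) λ eq → j≢ (trans (sym (strictlyInverseʳ j)) (cong from eq))))
      (trans (cong only (strictlyInverseˡ 0#)) only-0)

    unit≢0 : ∀ y → unit y ≢ 0#
    unit≢0 y with y ≟ 0#
    ... | yes _ = 0≢1 ∘ sym
    ... | no y≢0 = y≢0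

    prod≢0 : ∀ {n} (f : Fin n → Carrier) → (∀ i → f i ≢ 0#) → prod f ≢ 0#
    prod≢0 {zero} f f≢0 = 0≢1 ∘ sym
    prod≢0 {suc n} f f≢0 = x*y≢0 (f≢0 zero) (prod≢0 (f ∘ suc) (f≢0 ∘ suc))

    unit-scale : ∀ y → unit (x * y) ≡ unit y * rest y
    unit-scale y with y ≟ 0# | x * y ≟ 0#
    ... | yes refl | yes _ = sym (*-identityˡ 1#)
    ... | yes refl | no x0≢0 = contradiction (zeroʳ x) x0≢0
    ... | no y≢0 | yes xy≡0 = contradiction xy≡0 (x*y≢0 x≢0 y≢0)
    ... | no _ | no _ = *-comm x y

    prod-rest : prod (rest ∘ to) ≡ 1#
    prod-rest = *-cancelˡ (prod (unit ∘ to)) (prod≢0 (unit ∘ to) (unit≢0 ∘ to)) (begin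
      prod (unit ∘ to) * prod (rest ∘ to) ≡⟨ ∑-distrib-+ (unit ∘ to) (rest ∘ to) ⟨
      prod (λ i → unit (to i) * rest (to i)) ≡⟨ sum-cong-≗ (λ i → unit-scale (to i)) ⟨
      prod (λ i → unit (x * to i))        ≡⟨ sum-↔ *-commutativeMonoid unit (scale x x≢0 ↔-∘ index) index ⟩
      prod (unit ∘ to)                    ≡⟨ *-identityʳ _ ⟨
      prod (unit ∘ to) * 1#               ∎)

-- Polynomial functions

-- ev c (a₀ ∷ … ∷ aₙ₋₁ ∷ []) is the polynomial a₀ + a₁ X + … + aₙ₋₁ Xⁿ⁻¹ + c Xⁿ as a function.
module Polynomial (R : CommutativeRing 0ℓ 0ℓ) where
  open CommutativeRing R renaming (Carrier to A; refl to ≈-refl; sym to ≈-sym; trans to ≈-trans)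
  open Algebra.Solver.Ring.NaturalCoefficients.Default commutativeSemiring
    using (solve; con; _:+_; _:*_; _:=_)
  open import Relation.Binary.Reasoning.Setoid setoid

  ev : ∀ {n} → A → Vec A n → A → A
  ev c []      x = c
  ev c (a ∷ v) x = a + x * ev c v x

  ev-+ : ∀ {n} (v w : Vec A n) x → ev 0# (Vec.zipWith _+_ v w) x ≈ ev 0# v x + ev 0# w x
  ev-+ [] [] x = ≈-sym (+-identityˡ 0#)
  ev-+ (a ∷ v) (b ∷ w) x = begin
    (a + b) + x * ev 0# (Vec.zipWith _+_ v w) x ≈⟨ +-congˡ (*-congˡ (ev-+ v w x)) ⟩
    (a + b) + x * (ev 0# v x + ev 0# w x)
      ≈⟨ solve 5 (λ a b x p q → (a :+ b) :+ x :* (p :+ q) := (a :+ x :* p) :+ (b :+ x :* q)) ≈-refl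
           a b x (ev 0# v x) (ev 0# w x) ⟩
    (a + x * ev 0# v x) + (b + x * ev 0# w x) ∎

  ev-* : ∀ {n} a (v : Vec A n) c x → ev (a * c) (Vec.map (a *_) v) x ≈ a * ev c v x
  ev-* a [] c x = ≈-refl
  ev-* a (b ∷ v) c x = begin
    a * b + x * ev (a * c) (Vec.map (a *_) v) x ≈⟨ +-congˡ (*-congˡ (ev-* a v c x)) ⟩
    a * b + x * (a * ev c v x)
      ≈⟨ solve 4 (λ a b x p → a :* b :+ x :* (a :* p) := a :* (b :+ x :* p)) ≈-refl a b x (ev c v x) ⟩
    a * (b + x * ev c v x) ∎

  ev-cong : ∀ {n c c′} (v : Vec A n) x → c ≈ c′ → ev c v x ≈ ev c′ v x
  ev-cong []      x c≈c′ = c≈c′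
  ev-cong (a ∷ v) x c≈c′ = +-congˡ (*-congˡ (ev-cong v x c≈c′))

  -- Horner's scheme: the value at `r` of each tail is the next coefficient of the quotient, whose
  -- leading coefficient is still `c`.
  deflate : ∀ {n} c (f : Vec A (suc n)) r →
    Σ (Vec A n) λ h → ∀ x → ev c f x ≈ (x + - r) * ev c h x + ev c f r
  deflate c (b ∷ []) r = [] , λ x → begin
    b + x * c                             ≈⟨ +-congʳ (+-identityʳ b) ⟨
    -- The solver handles commutative semirings, so `- r` is passed as an opaque variable and the
    -- zero `- r + r` is inserted by hand.
    b + 0# + x * c                        ≈⟨ +-congʳ (+-congˡ (≈-trans (*-congʳ (-‿inverseˡ r)) (zeroˡ c))) ⟨
    b + (- r + r) * c + x * c
      ≈⟨ solve 5 (λ b r s x c → b :+ (s :+ r) :* c :+ x :* c := (x :+ s) :* c :+ (b :+ r :* c)) ≈-refl b r (- r) x c ⟩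
    (x + - r) * c + (b + r * c)           ∎
  deflate c (b ∷ f@(_ ∷ _)) r with h , eq ← deflate c f r = ev c f r ∷ h , λ x → begin
    b + x * ev c f x                                            ≈⟨ +-congˡ (*-congˡ (eq x)) ⟩
    b + x * ((x + - r) * ev c h x + ev c f r)                   ≈⟨ +-congʳ (+-identityʳ b) ⟨
    b + 0# + x * ((x + - r) * ev c h x + ev c f r)
      ≈⟨ +-congʳ (+-congˡ (≈-trans (*-congʳ (-‿inverseˡ r)) (zeroˡ (ev c f r)))) ⟨
    b + (- r + r) * ev c f r + x * ((x + - r) * ev c h x + ev c f r)
      ≈⟨ solve 6 (λ b r s x p q → b :+ (s :+ r) :* q :+ x :* ((x :+ s) :* p :+ q)
                    := (x :+ s) :* (q :+ x :* p) :+ (b :+ r :* q)) ≈-refl b r (- r) x (ev c h x) (ev c f r) ⟩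
    (x + - r) * (ev c f r + x * ev c h x) + (b + r * ev c f r)  ∎

  module Division (L : A → Set)
    (L+ : ∀ {a b} → L a → L b → L (a + b)) (L* : ∀ {a b} → L a → L b → L (a * b)) (L- : ∀ {a} → L a → L (- a)) where

    -- Multiplying by X raises the degree bound by one; `top` is the coefficient of X^k split off
    -- from the result.
    shift : ∀ {k} (a : A) (f : Vec A k) → L a → All L f →
      Σ A λ top → Σ (Vec A k) λ g → L top × All L g × (∀ x → a + x * ev 0# f x ≈ ev top g x)
    shift a [] La [] = a , [] , La , [] , λ x → ≈-trans (+-congˡ (zeroʳ x)) (+-identityʳ a)
    shift a (b ∷ f) La (Lb ∷ Lf) with top , g , Ltop , Lg , eq ← shift b f Lb Lf =
      top , a ∷ g , Ltop , La ∷ Lg , λ x → +-congˡ (*-congˡ (eq x))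

    module _ {k} (g : Vec A k) (Lg : All L g) where

      reduceTop : ∀ c (f : Vec A k) → L c → All L f →
        Σ (Vec A k) λ r → All L r × (∀ x → ev c f x ≈ ev 1# g x * c + ev 0# r x)
      reduceTop c f Lc Lf = go g f Lg Lf
        where
        go : ∀ {k} (g f : Vec A k) → All L g → All L f →
          Σ (Vec A k) λ r → All L r × (∀ x → ev c f x ≈ ev 1# g x * c + ev 0# r x)
        go [] [] [] [] = [] , [] , λ x → ≈-sym (≈-trans (+-identityʳ _) (*-identityˡ c))
        go (b ∷ g) (a ∷ f) (Lb ∷ Lg) (La ∷ Lf) with r , Lr , eq ← go g f Lg Lf =
          a + - b * c ∷ r , L+ La (L* (L- Lb) Lc) ∷ Lr , λ x → begin
            a + x * ev c f x                                ≈⟨ +-congˡ (*-congˡ (eq x)) ⟩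
            a + x * (ev 1# g x * c + ev 0# r x)             ≈⟨ +-congʳ (+-identityʳ a) ⟨
            a + 0# + x * (ev 1# g x * c + ev 0# r x)
              ≈⟨ +-congʳ (+-congˡ (≈-trans (*-congʳ (-‿inverseˡ b)) (zeroˡ c))) ⟨
            a + (- b + b) * c + x * (ev 1# g x * c + ev 0# r x)
              ≈⟨ solve 7 (λ a b s x p q c → a :+ (s :+ b) :* c :+ x :* (p :* c :+ q)
                            := (b :+ x :* p) :* c :+ ((a :+ s :* c) :+ x :* q)) ≈-refl
                   a b (- b) x (ev 1# g x) (ev 0# r x) c ⟩
            (b + x * ev 1# g x) * c + (a + - b * c + x * ev 0# r x) ∎

      reduceShift : ∀ a (f : Vec A k) → L a → All L f →
        Σ A λ c → L c × Σ (Vec A k) λ r → All L r × (∀ x → a + x * ev 0# f x ≈ ev 1# g x * c + ev 0# r x)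
      reduceShift a f La Lf with c , f′ , Lc , Lf′ , eq ← shift a f La Lf with r , Lr , eq′ ← reduceTop c f′ Lc Lf′ =
        c , Lc , r , Lr , λ x → ≈-trans (eq x) (eq′ x)

      -- Since `g` is monic, no coefficient is inverted and everything stays over `L`. The tail of
      -- `f` is divided first; one reduction of a + X r′ then yields the constant coefficient of the
      -- quotient.
      divide : ∀ {t} c (f : Vec A (t ℕ.+ k)) → L c → All L f →
        Σ (Vec A t) λ h → Σ (Vec A k) λ r → All L h × All L r ×
          (∀ x → ev c f x ≈ ev 1# g x * ev c h x + ev 0# r x)
      divide {zero} c f Lc Lf with r , Lr , eq ← reduceTop c f Lc Lf = [] , r , [] , Lr , eq
      divide {suc t} c (a ∷ f) Lc (La ∷ Lf)
        with h , r′ , Lh , Lr′ , eq ← divide {t} c f Lc Lf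
        with b , Lb , r , Lr , eq′ ← reduceShift a r′ La Lr′ =
        b ∷ h , r , Lb ∷ Lh , Lr , λ x → begin
          a + x * ev c f x                                   ≈⟨ +-congˡ (*-congˡ (eq x)) ⟩
          a + x * (ev 1# g x * ev c h x + ev 0# r′ x)
            ≈⟨ solve 5 (λ a x p q r → a :+ x :* (p :* q :+ r) := p :* (x :* q) :+ (a :+ x :* r)) ≈-refl
                 a x (ev 1# g x) (ev c h x) (ev 0# r′ x) ⟩
          ev 1# g x * (x * ev c h x) + (a + x * ev 0# r′ x)  ≈⟨ +-congˡ (eq′ x) ⟩
          ev 1# g x * (x * ev c h x) + (ev 1# g x * b + ev 0# r x)
            ≈⟨ solve 5 (λ b x p q r → p :* (x :* q) :+ (p :* b :+ r) := p :* (b :+ x :* q) :+ r) ≈-refl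
                 b x (ev 1# g x) (ev c h x) (ev 0# r x) ⟩
          ev 1# g x * (b + x * ev c h x) + ev 0# r x         ∎

module RootBound {Q : ℕ} (K : FiniteField Q) where
  open Field K
  open Polynomial ring

  -- `deflate` splits off one root; the others differ from it, so they remain roots of the cofactor,
  -- a field having no zero divisors. At degree 0 the monic cofactor is the constant 1, which has no
  -- root.
  roots≤degree : ∀ {t n} (h : Vec Carrier t) (ρ : Fin n → Carrier) →
    (∀ i j → ρ i ≡ ρ j → i ≡ j) → (∀ i → ev 1# h (ρ i) ≡ 0#) → n ℕ.≤ t
  roots≤degree {t} {zero} h ρ ρ-inj root = z≤n
  roots≤degree {zero} {suc n} [] ρ ρ-inj root = contradiction (≡.sym (root zero)) 0≢1
  roots≤degree {suc t} {suc n} h ρ ρ-inj root with h′ , eq ← deflate 1# h (ρ zero) =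
    s≤s (roots≤degree h′ (ρ ∘ suc) (λ i j → Finₚ.suc-injective ∘ ρ-inj (suc i) (suc j)) λ i →
      x*y≡0⇒y≡0
        (λ diff → Finₚ.0≢1+n (≡.sym (ρ-inj (suc i) zero (x-y≡0⇒x≡y diff))))
        (≡.trans (≡.sym (+-identityʳ _))
          (≡.trans (cong ((ρ (suc i) + - ρ zero) * ev 1# h′ (ρ (suc i)) +_) (≡.sym (root zero)))
            (≡.trans (≡.sym (eq (ρ (suc i)))) (root (suc i))))))

-- The embedding of F into K

-- For a `P` without a decision procedure, a least witness can only be shown not to be absent. It is
-- applied to the degrees of annihilating polynomials over a graph.
¬¬-least : (P : ℕ → Set) → ∀ n → P n → ¬ ¬ (Σ ℕ λ k → P k × (∀ j → j ℕ.< k → ¬ P j))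
¬¬-least P n Pn none = <-rec (λ m → ¬ P m) (λ m below Pm → none (m , Pm , λ j j<m → below j<m)) n Pn

All-zipWith : ∀ {A : Set} {P : A → Set} {_∙_ : A → A → A} → (∀ {a b} → P a → P b → P (a ∙ b)) →
  ∀ {n} {v w : Vec A n} → All P v → All P w → All P (Vec.zipWith _∙_ v w)
All-zipWith P∙ [] [] = []
All-zipWith P∙ (p ∷ ps) (q ∷ qs) = P∙ p q ∷ All-zipWith P∙ ps qs

All-replicate : ∀ {A : Set} {P : A → Set} {a} → P a → ∀ n → All P (Vec.replicate n a)
All-replicate Pa zero = []
All-replicate Pa (suc n) = Pa ∷ All-replicate Pa n

record IsFieldHom {q Q : ℕ} (F : FiniteField q) (K : FiniteField Q)
    (φ : FiniteField.Carrier F → FiniteField.Carrier K) : Set where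
  private
    module F = Field F
    module K = Field K
  field
    1-homo : φ F.1# ≡ K.1#
    +-homo : ∀ x y → φ (x F.+ y) ≡ φ x K.+ φ y
    *-homo : ∀ x y → φ (x F.* y) ≡ φ x K.* φ y

module Embedding {q Q : ℕ} (F : FiniteField q) (K : FiniteField (suc (suc Q))) where
  private
    module F = Field F
    module K = Field K

  R : CommutativeRing 0ℓ 0ℓ
  R = DirectProduct.commutativeRing F.ring K.ring

  open CommutativeRing R renaming (Carrier to A; refl to ≈-refl; sym to ≈-sym; trans to ≈-trans) hiding (zero)
  open Polynomial R
  open Algebra.Solver.Ring.NaturalCoefficients.Default commutativeSemiring
    using (solve; con; _:+_; _:*_; _:=_)
  open Mult +-monoid using (×-homo-+) renaming (_×_ to _·_)
  open SemiringMult semiring using (×1-homo-*)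
  open Mult *-monoid using () renaming (_×_ to power)
  open RingProperties (CommutativeRing.ring R) using (-1*x≈-x; -‿distribʳ-*)
  open import Relation.Binary.Reasoning.Setoid setoid

  ≈⇒≡ : ∀ {a b} → a ≈ b → a ≡ b
  ≈⇒≡ (eq , eq′) = cong₂ _,_ eq eq′

  -- Lets vanishing at `α` in `F` be stated with a dummy second coordinate, before a matching `β` in
  -- `K` has been found.
  ev-proj₁ : ∀ {n} c (v : Vec A n) α β β′ → proj₁ (ev c v (α , β)) ≡ proj₁ (ev c v (α , β′))
  ev-proj₁ c [] α β β′ = refl
  ev-proj₁ c (a ∷ v) α β β′ = cong (λ z → proj₁ a F.+ α F.* z) (ev-proj₁ c v α β β′)

  ev-proj₂ : ∀ {n} c (v : Vec A n) x →
    proj₂ (ev c v x) ≡ Polynomial.ev K.ring (proj₂ c) (Vec.map proj₂ v) (proj₂ x)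
  ev-proj₂ c [] x = refl
  ev-proj₂ c (a ∷ v) x = cong (λ z → proj₂ a K.+ proj₂ x K.* z) (ev-proj₂ c v x)

  power-proj₁ : ∀ n a → proj₁ (power n a) ≡ proj₁ a F.^ n
  power-proj₁ zero a = refl
  power-proj₁ (suc n) a = cong (proj₁ a F.*_) (power-proj₁ n a)

  power-proj₂ : ∀ n a → proj₂ (power n a) ≡ proj₂ a K.^ n
  power-proj₂ zero a = refl
  power-proj₂ (suc n) a = cong (proj₂ a K.*_) (power-proj₂ n a)

  ev-zero : ∀ {n} (v : Vec A n) x → All (_≈ 0#) v → ev 0# v x ≈ 0#
  ev-zero [] x [] = ≈-refl
  ev-zero (a ∷ v) x (a≈0 ∷ v≈0) = begin
    a + x * ev 0# v x   ≈⟨ +-cong a≈0 (*-congˡ (ev-zero v x v≈0)) ⟩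
    0# + x * 0#         ≈⟨ ≈-trans (+-identityˡ _) (zeroʳ x) ⟩
    0#                  ∎

  ev-power : ∀ n x → ev 1# (Vec.replicate n 0#) x ≈ power n x
  ev-power zero x = ≈-refl
  ev-power (suc n) x = ≈-trans (+-identityˡ _) (*-congˡ (ev-power n x))

  -- A subring of F × K that is the graph of a partial homomorphism from F to K.
  record IsGraph (L : A → Set) : Set where
    field
      L1 : L 1#
      L+ : ∀ {a b} → L a → L b → L (a + b)
      L* : ∀ {a b} → L a → L b → L (a * b)
      L- : ∀ {a} → L a → L (- a)
      -- By subtraction, single-valuedness need only be required over 0.
      functional : ∀ {a} → L a → proj₁ a ≡ F.0# → proj₂ a ≡ K.0#

    L≈ : ∀ {a b} → a ≈ b → L a → L b
    L≈ a≈b = subst L (≈⇒≡ a≈b)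

    L0 : L 0#
    L0 = L≈ (-‿inverseʳ 1#) (L+ L1 (L- L1))

    Lpower : ∀ n {a} → L a → L (power n a)
    Lpower zero La = L1
    Lpower (suc n) La = L* La (Lpower n La)

    ≈0 : ∀ {a} → L a → proj₁ a ≡ F.0# → a ≈ 0#
    ≈0 La eq = eq , functional La eq

  module Adjoin (fermat : ∀ x → x F.^ suc (suc Q) ≡ x) {L : A → Set} (isGraph : IsGraph L) (α : F.Carrier) where
    open IsGraph isGraph
    open Division L L+ L* L-

    -- The inverse must lie in `L`, hence is taken as a power: `K` has Q + 2 elements, so c · (c ·
    -- c^Q) = c gives c · c^Q = 1 in `F`, and `functional` carries this equation to `K`.
    L-inverse : ∀ {c} → L c → proj₁ c ≢ F.0# → Σ A λ c⁻¹ → L c⁻¹ × c⁻¹ * c ≈ 1#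
    L-inverse {c} Lc c≢0 = power Q c , Lpower Q Lc , ≈-trans (*-comm _ c) cc⁻¹≈1
      where
      diff≈0 : c * power Q c + - 1# ≈ 0#
      diff≈0 = ≈0 (L+ (L* Lc (Lpower Q Lc)) (L- L1))
        (≡.trans
          (cong (F._+ F.- F.1#) (F.*-cancelˡ (proj₁ c) c≢0
            (≡.trans (cong (λ z → proj₁ c F.* (proj₁ c F.* z)) (power-proj₁ Q c))
              (≡.trans (fermat (proj₁ c)) (≡.sym (F.*-identityʳ _))))))
          (F.-‿inverseʳ F.1#))
      cc⁻¹≈1 : c * power Q c ≈ 1#
      cc⁻¹≈1 = F.x-y≡0⇒x≡y (proj₁ diff≈0) , K.x-y≡0⇒x≡y (proj₂ diff≈0)

    -- One of least degree plays the role of the minimal polynomial of `α`. `K.0#` is the dummy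
    -- coordinate of `ev-proj₁`.
    Annihilator : ℕ → Set
    Annihilator k = Σ (Vec A k) λ g → All L g × proj₁ (ev 1# g (α , K.0#)) ≡ F.0#

    -- This is X^N - X with N = Q + 2. The length is given by an equation so that it can be supplied
    -- in the shape `t + k` that `divide` expects.
    frobenius : ∀ n → n ≡ suc (suc Q) → Σ (Vec A n) λ f → All L f × (∀ x → ev 1# f x ≈ 0#)
    frobenius _ refl = f , L0 ∷ L- L1 ∷ All-replicate L0 Q , λ x → begin
      0# + x * (- 1# + x * ev 1# (Vec.replicate Q 0#) x) ≈⟨ +-identityˡ _ ⟩
      x * (- 1# + x * ev 1# (Vec.replicate Q 0#) x)      ≈⟨ *-congˡ (+-congˡ (*-congˡ (ev-power Q x))) ⟩
      x * (- 1# + x * power Q x)                         ≈⟨ distribˡ x _ _ ⟩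
      x * - 1# + x * (x * power Q x)                     ≈⟨ +-cong (≈-trans (≈-sym (-‿distribʳ-* x 1#)) (-‿cong (*-identityʳ x))) (power≈ x) ⟩
      - x + x                                            ≈⟨ -‿inverseˡ x ⟩
      0#                                                 ∎
      where
      f : Vec A (suc (suc Q))
      f = 0# ∷ - 1# ∷ Vec.replicate Q 0#
      power≈ : ∀ x → power (suc (suc Q)) x ≈ x
      power≈ x = ≡.trans (power-proj₁ (suc (suc Q)) x) (fermat (proj₁ x)) ,
                 ≡.trans (power-proj₂ (suc (suc Q)) x) (K.x^card≡x (proj₂ x))

    -- By `functional`, an element of `L` can be tested for zero on its first component alone; this
    -- locates the true leading coefficient.
    zeroOrLeading : ∀ {n} (f : Vec A n) → All L f → All (_≈ 0#) f ⊎
      (Σ ℕ λ j → j ℕ.< n × Σ A λ c → L c × proj₁ c ≢ F.0# ×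
       Σ (Vec A j) λ g → All L g × (∀ x → ev 0# f x ≈ ev c g x))
    zeroOrLeading [] [] = inj₁ []
    zeroOrLeading (a ∷ f) (La ∷ Lf) with zeroOrLeading f Lf
    ... | inj₂ (j , j<n , c , Lc , c≢0 , g , Lg , eq) =
      inj₂ (suc j , s≤s j<n , c , Lc , c≢0 , a ∷ g , La ∷ Lg , λ x → +-congˡ (*-congˡ (eq x)))
    ... | inj₁ f≈0 with proj₁ a F.≟ F.0#
    ... | yes a≡0 = inj₁ (≈0 La a≡0 ∷ f≈0)
    ... | no a≢0 = inj₂ (0 , s≤s z≤n , a , La , a≢0 , [] , [] ,
      λ x → ≈-trans (+-congˡ (≈-trans (*-congˡ (ev-zero f x f≈0)) (zeroʳ x))) (+-identityʳ a))

    module Minimal {k} (g : Vec A k) (Lg : All L g) (gα≡0 : proj₁ (ev 1# g (α , K.0#)) ≡ F.0#)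
      (minimal : ∀ j → j ℕ.< k → ¬ Annihilator j) where

      -- A nonzero `r` could be divided by its leading coefficient, giving a monic annihilator of
      -- degree below `k`. The conclusion concerns both components: vanishing at `α` in `F` forces
      -- zero coefficients in `K`.
      small-vanishing : (r : Vec A k) → All L r → proj₁ (ev 0# r (α , K.0#)) ≡ F.0# → All (_≈ 0#) r
      small-vanishing r Lr rα≡0 with zeroOrLeading r Lr
      ... | inj₁ r≈0 = r≈0
      ... | inj₂ (j , j<k , c , Lc , c≢0 , h , Lh , eq) with c⁻¹ , Lc⁻¹ , c⁻¹c≈1 ← L-inverse Lc c≢0 =
        contradiction (Vec.map (c⁻¹ *_) h , Allₚ.gmap (L* Lc⁻¹) Lh , proj₁ root) (minimal j j<k)
        where
        X : A
        X = α , K.0#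
        root : ev 1# (Vec.map (c⁻¹ *_) h) X ≈ (F.0# , proj₂ (c⁻¹ * ev c h X))
        root = begin
          ev 1# (Vec.map (c⁻¹ *_) h) X        ≈⟨ ev-cong (Vec.map (c⁻¹ *_) h) X c⁻¹c≈1 ⟨
          ev (c⁻¹ * c) (Vec.map (c⁻¹ *_) h) X ≈⟨ ev-* c⁻¹ h c X ⟩
          c⁻¹ * ev c h X
            ≈⟨ ≡.trans (cong (proj₁ c⁻¹ F.*_) (≡.trans (≡.sym (proj₁ (eq X))) rα≡0)) (F.zeroʳ _) , refl ⟩
          (F.0# , proj₂ (c⁻¹ * ev c h X))     ∎

      degree≤card : k ℕ.≤ suc (suc Q)
      degree≤card = ℕₚ.≮⇒≥ λ card<k → minimal _ card<k
        (let f , Lf , f≈0 = frobenius _ refl in f , Lf , proj₁ (f≈0 _))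

      -- The annihilator g divides X^Q - X, which vanishes on all of K; if g had no root in K,
      -- the cofactor would have more roots than its degree.
      rootInK : Σ K.Carrier λ β → ev 1# g (α , β) ≈ 0#
      rootInK with t , t+k≡Q ← (suc (suc Q) ℕ.∸ k , ℕₚ.m∸n+n≡m degree≤card)
        with f , Lf , f≈0 ← frobenius (t ℕ.+ k) t+k≡Q
        with h , r , Lh , Lr , eq ← divide g Lg {t} 1# f L1 Lf
        with K.exhaustible (λ β → proj₂ (ev 1# g (α , β)) ≡ K.0#) (λ β → _ K.≟ _)
      ... | yes (β , gβ≡0) = β , ≡.trans (ev-proj₁ 1# g α β K.0#) gα≡0 , gβ≡0
      ... | no noRoot = contradiction (t<t k g gα≡0 t+k≡Q) (ℕₚ.<⇒≱ ℕₚ.≤-refl)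
        where
        -- Both X^N - X and `g` vanish at `α`, so `r` does. Its coefficients are then zero in `K`
        -- too, and the factorisation becomes valid over `K`.
        r≈0 : All (_≈ 0#) r
        r≈0 = small-vanishing r Lr (≡.sym (≡.trans (≡.sym (proj₁ (f≈0 (α , K.0#))))
          (≡.trans (proj₁ (eq (α , K.0#)))
            (≡.trans (cong (F._+ proj₁ (ev 0# r (α , K.0#))) (≡.trans (cong (F._* _) gα≡0) (F.zeroˡ _))) (F.+-identityˡ _)))))
        gh≈0 : ∀ x → ev 1# g x * ev 1# h x ≈ 0#
        gh≈0 x = begin
          ev 1# g x * ev 1# h x              ≈⟨ +-identityʳ _ ⟨
          ev 1# g x * ev 1# h x + 0#         ≈⟨ +-congˡ (ev-zero r x r≈0) ⟨
          ev 1# g x * ev 1# h x + ev 0# r x  ≈⟨ eq x ⟨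
          ev 1# f x                          ≈⟨ f≈0 x ⟩
          0#                                 ∎
        Q≤t : suc (suc Q) ℕ.≤ t
        Q≤t = RootBound.roots≤degree K (Vec.map proj₂ h) (Inverse.to K.index)
          (λ i j eq → ≡.trans (≡.sym (Inverse.strictlyInverseʳ K.index i))
             (≡.trans (cong (Inverse.from K.index) eq) (Inverse.strictlyInverseʳ K.index j)))
          (λ i → ≡.trans (≡.sym (ev-proj₂ 1# h (α , Inverse.to K.index i)))
            (K.x*y≡0⇒y≡0 (λ gβ≡0 → noRoot (Inverse.to K.index i , gβ≡0)) (proj₂ (gh≈0 (α , Inverse.to K.index i)))))
        t<t : ∀ k (g : Vec A k) → proj₁ (ev 1# g (α , K.0#)) ≡ F.0# → t ℕ.+ k ≡ suc (suc Q) → t ℕ.< t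
        t<t zero [] 1≡0 _ = contradiction (≡.sym 1≡0) F.0≢1
        t<t (suc k) _ _ t+k≡Q = ℕₚ.≤-trans (s≤s (ℕₚ.m≤m+n t k)) (ℕₚ.≤-trans (ℕₚ.≤-reflexive (≡.trans (≡.sym (ℕₚ.+-suc t k)) t+k≡Q)) Q≤t)

      module _ (β : K.Carrier) (g≈0 : ev 1# g (α , β) ≈ 0#) where
        X : A
        X = α , β

        -- The ring generated by `L` and the pair `X`. As `g` is monic and vanishes at `X`,
        -- polynomials with `k` coefficients exhaust it, and this bound is what lets
        -- `small-vanishing` give `functional`.
        M : A → Set
        M a = Σ (Vec A k) λ r → All L r × a ≈ ev 0# r X

        M≈ : ∀ {a b} → a ≈ b → M a → M b
        M≈ a≈b = subst M (≈⇒≡ a≈b)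

        M+ : ∀ {a b} → M a → M b → M (a + b)
        M+ (r , Lr , eq) (s , Ls , eq′) =
          Vec.zipWith _+_ r s , All-zipWith L+ Lr Ls , ≈-trans (+-cong eq eq′) (≈-sym (ev-+ r s X))

        M-scale : ∀ {a b} → L a → M b → M (a * b)
        M-scale {a} {b} La (r , Lr , eq) = Vec.map (a *_) r , Allₚ.gmap (L* La) Lr , (begin
          a * b                                ≈⟨ *-congˡ eq ⟩
          a * ev 0# r X                        ≈⟨ ev-* a r 0# X ⟨
          ev (a * 0#) (Vec.map (a *_) r) X     ≈⟨ ev-cong (Vec.map (a *_) r) X (zeroʳ a) ⟩
          ev 0# (Vec.map (a *_) r) X           ∎)

        M-shift : ∀ {a b} → L a → M b → M (a + X * b)
        M-shift {a} {b} La (r , Lr , eq) with c , Lc , s , Ls , eq′ ← reduceShift g Lg a r La Lr =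
          s , Ls , (begin
            a + X * b                       ≈⟨ +-congˡ (*-congˡ eq) ⟩
            a + X * ev 0# r X               ≈⟨ eq′ X ⟩
            ev 1# g X * c + ev 0# s X       ≈⟨ +-congʳ (≈-trans (*-congʳ g≈0) (zeroˡ c)) ⟩
            0# + ev 0# s X                  ≈⟨ +-identityˡ _ ⟩
            ev 0# s X                       ∎)

        M0 : M 0#
        M0 = Vec.replicate k 0# , All-replicate L0 k , ≈-sym (ev-zero _ X (All-replicate ≈-refl k))

        L⊆M : ∀ {a} → L a → M a
        L⊆M {a} La = M≈ (≈-trans (+-congˡ (zeroʳ X)) (+-identityʳ a)) (M-shift La M0)

        -- Closure under products: the first factor is expanded by Horner's scheme, so addition,
        -- scaling by `L` and multiplication by `X` suffice.
        M-ev* : ∀ {n} (v : Vec A n) → All L v → ∀ {b} → M b → M (ev 0# v X * b)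
        M-ev* [] [] {b} Mb = M≈ (≈-sym (zeroˡ b)) M0
        M-ev* (a ∷ v) (La ∷ Lv) {b} Mb = M≈
          (≈-trans (+-congˡ (+-identityˡ _))
            (solve 4 (λ a x e b → a :* b :+ x :* (e :* b) := (a :+ x :* e) :* b) ≈-refl a X (ev 0# v X) b))
          (M+ (M-scale La Mb) (M-shift L0 (M-ev* v Lv Mb)))

        M-isGraph : IsGraph M
        M-isGraph = record
          { L1 = L⊆M L1
          ; L+ = M+
          ; L* = λ (r , Lr , eq) Mb → M≈ (*-congʳ (≈-sym eq)) (M-ev* r Lr Mb)
          ; L- = λ Ma → M≈ (-1*x≈-x _) (M-scale (L- L1) Ma)
          ; functional = λ (r , Lr , eq) a≡0 → ≡.trans (proj₂ eq) (proj₂ (ev-zero r X (small-vanishing r Lr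
              (≡.trans (ev-proj₁ 0# r α K.0# β) (≡.trans (≡.sym (proj₁ eq)) a≡0)))))
          }

        X∈M : M X
        X∈M = M≈ (≈-trans (+-identityˡ _) (*-identityʳ X)) (M-shift L0 (L⊆M L1))

    adjoin : ¬ ¬ (Σ (A → Set) λ M → IsGraph M × (∀ {a} → L a → M a) × Σ K.Carrier λ β → M (α , β))
    adjoin none = ¬¬-least Annihilator (suc (suc Q))
      (let f , Lf , f≈0 = frobenius _ refl in f , Lf , proj₁ (f≈0 _))
      λ (k , (g , Lg , gα≡0) , minimal) →
        let open Minimal g Lg gα≡0 minimal
            β , g≈0 = rootInK
        in none (M β g≈0 , M-isGraph β g≈0 , L⊆M β g≈0 , β , X∈M β g≈0)

  graph-unique : ∀ {L} → IsGraph L → ∀ {x y y′} → L (x , y) → L (x , y′) → y ≡ y′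
  graph-unique isGraph {x} Ly Ly′ =
    K.x-y≡0⇒x≡y (functional (L+ Ly (L- Ly′)) (F.-‿inverseʳ x))
    where open IsGraph isGraph

  Total : Set₁
  Total = Σ (A → Set) λ L → IsGraph L × (∀ x → Σ K.Carrier λ y → L (x , y))

  totalGraph : (∀ x → x F.^ suc (suc Q) ≡ x) → Σ (A → Set) IsGraph → ¬ ¬ Total
  totalGraph fermat initial none = loop (Vec.tabulate (Inverse.to F.index)) λ (L , isGraph , covers) →
    none (L , isGraph , λ x → subst (λ x → Σ K.Carrier λ y → L (x , y))
      (≡.trans (Vecₚ.lookup∘tabulate _ (Inverse.from F.index x)) (Inverse.strictlyInverseˡ F.index x))
      (Allₚ.lookup⁺ covers (Inverse.from F.index x)))
    where
    loop : ∀ {n} (xs : Vec F.Carrier n) →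
      ¬ ¬ (Σ (A → Set) λ L → IsGraph L × All (λ x → Σ K.Carrier λ y → L (x , y)) xs)
    loop [] none = none (proj₁ initial , proj₂ initial , [])
    loop (x ∷ xs) none = loop xs λ (L , isGraph , covers) →
      Adjoin.adjoin fermat isGraph x λ (M , M-isGraph , L⊆M , y , My) →
        none (M , M-isGraph , (y , My) ∷ All.map (λ (y , Ly) → y , L⊆M Ly) covers)

  -- A homomorphism as a finite table, so that its existence is decidable.
  IsHomTable : Vec K.Carrier q → Set
  IsHomTable v = IsFieldHom F K (λ x → Vec.lookup v (Inverse.from F.index x))

  isHomTable? : ∀ v → Dec (IsHomTable v)
  isHomTable? v = map′
    (λ (p , q , r) → record { 1-homo = p ; +-homo = q ; *-homo = r })
    (λ h → IsFieldHom.1-homo h , IsFieldHom.+-homo h , IsFieldHom.*-homo h)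
    (_ K.≟ _ ×-dec all (λ x → all λ y → _ K.≟ _) ×-dec all (λ x → all λ y → _ K.≟ _))
    where
    all : ∀ {P : F.Carrier → Set} → (∀ x → Dec (P x)) → Dec (∀ x → P x)
    all = exhaustible-∀ F.exhaustible _

  table : Total → Σ (Vec K.Carrier q) IsHomTable
  table (L , isGraph , total) = v , record
    { 1-homo = graph-unique isGraph (Lφ F.1#) L1
    ; +-homo = λ x y → graph-unique isGraph (Lφ (x F.+ y)) (L+ (Lφ x) (Lφ y))
    ; *-homo = λ x y → graph-unique isGraph (Lφ (x F.* y)) (L* (Lφ x) (Lφ y))
    }
    where
    open IsGraph isGraph
    open Inverse F.index using (to; from; strictlyInverseˡ)
    v : Vec K.Carrier q
    v = Vec.tabulate (λ i → proj₁ (total (to i)))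
    Lφ : ∀ x → L (x , Vec.lookup v (from x))
    Lφ x = subst L (cong₂ _,_ (strictlyInverseˡ x) (≡.sym (Vecₚ.lookup∘tabulate _ (from x)))) (proj₂ (total (to (from x))))

  embedding : (∀ x → x F.^ suc (suc Q) ≡ x) → Σ (A → Set) IsGraph → Σ (F.Carrier → K.Carrier) (IsFieldHom F K)
  embedding fermat initial = _ , proj₂ (decidable-stable
    (exhaustible-Vec K.exhaustible q IsHomTable isHomTable?)
    λ none → totalGraph fermat initial (none ∘ table))

  -- The graph between the prime fields. Natural multiples of 1 already contain `- 1#`, which equals
  -- `p · 1#` because `suc p · 1#` vanishes.
  prime-isGraph : ∀ p → suc p · 1# ≈ 0# → (∀ n → proj₁ (n · 1#) ≡ F.0# → proj₂ (n · 1#) ≡ K.0#) →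
    IsGraph (λ a → Σ ℕ λ n → a ≈ n · 1#)
  prime-isGraph p p·1≈0 char = record
    { L1 = 1 , ≈-sym (+-identityʳ 1#)
    ; L+ = λ (m , eq) (n , eq′) → m ℕ.+ n , ≈-trans (+-cong eq eq′) (≈-sym (×-homo-+ 1# m n))
    ; L* = L*
    ; L- = λ {a} (n , eq) → L≈ (-1*x≈-x a) (L* L-1 (n , eq))
    ; functional = λ (n , eq) a≡0 → ≡.trans (proj₂ eq) (char n (≡.trans (≡.sym (proj₁ eq)) a≡0))
    }
    where
    L : A → Set
    L a = Σ ℕ λ n → a ≈ n · 1#
    L≈ : ∀ {a b} → a ≈ b → L a → L b
    L≈ a≈b (n , eq) = n , ≈-trans (≈-sym a≈b) eq
    L* : ∀ {a b} → L a → L b → L (a * b)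
    L* (m , eq) (n , eq′) = m ℕ.* n , ≈-trans (*-cong eq eq′) (≈-sym (×1-homo-* m n))
    L-1 : L (- 1#)
    L-1 = p , (begin
      - 1#                       ≈⟨ +-identityʳ _ ⟨
      - 1# + 0#                  ≈⟨ +-congˡ p·1≈0 ⟨
      - 1# + (1# + p · 1#)       ≈⟨ +-assoc _ _ _ ⟨
      (- 1# + 1#) + p · 1#       ≈⟨ +-congʳ (-‿inverseˡ 1#) ⟩
      0# + p · 1#                ≈⟨ +-identityˡ _ ⟩
      p · 1#                     ∎)

-- The characteristic and the start of the embedding

module Characteristic {Q : ℕ} (K : FiniteField Q) where
  open Field K
  open SemiringMult semiring using (×1-homo-*)
  open Mult (CommutativeRing.+-monoid ring) using (×-homo-+)

  p·1≡0 : ∀ p e → (p ℕ.^ e) · 1# ≡ 0# → p · 1# ≡ 0#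
  p·1≡0 p zero    1·1≡0 = contradiction (trans (sym 1·1≡0) (+-identityʳ 1#)) (0≢1)
  p·1≡0 p (suc e) eq with p · 1# ≟ 0#
  ... | yes p≡0 = p≡0
  ... | no p≢0 = p·1≡0 p e (x*y≡0⇒y≡0 p≢0 (trans (sym (×1-homo-* p (p ℕ.^ e))) eq))

  multiple·1≡0 : ∀ {p n} → p · 1# ≡ 0# → p ∣ n → n · 1# ≡ 0#
  multiple·1≡0 {p} p≡0 (divides c refl) = trans (×1-homo-* c p) (trans (cong (c · 1# *_) p≡0) (zeroʳ _))

  1+·1≢0 : ∀ {m n} → m · 1# ≡ 0# → 1 ℕ.+ m ≡ n → n · 1# ≢ 0#
  1+·1≢0 {m} m≡0 refl eq = 0≢1 (trans (sym eq) (trans (cong (1# +_) m≡0) (+-identityʳ 1#)))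

  -- Otherwise `p` and `n` are coprime and Bézout gives consecutive multiples of them; both
  -- annihilate 1, whence 1 = 0. Through divisibility by `p`, the relation n · 1 = 0 passes from `F`
  -- to `K`.
  vanishing⇒multiple : ∀ {p n} → Prime p → p · 1# ≡ 0# → n · 1# ≡ 0# → p ∣ n
  vanishing⇒multiple {p} {n} p-prime p≡0 n≡0 with p ∣? n
  ... | yes p∣n = p∣n
  ... | no p∤n with coprime-Bézout {p} {n} (λ (d∣p , d∣n) →
      [ id , (λ { refl → contradiction d∣n p∤n }) ]′ (prime⇒irreducible p-prime d∣p))
  ... | Bézout.+- x y eq = contradiction (multiple·1≡0 p≡0 (divides x refl))
          (1+·1≢0 (multiple·1≡0 n≡0 (divides y refl)) eq)
  ... | Bézout.-+ x y eq = contradiction (multiple·1≡0 n≡0 (divides y refl))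
          (1+·1≢0 (multiple·1≡0 p≡0 (divides x refl)) eq)

card≥2 : ∀ {Q} → FiniteField Q → Σ ℕ λ n → Q ≡ suc (suc n)
card≥2 {zero} K with () ← Inverse.from (Field.index K) (Field.0# K)
card≥2 {suc zero} K = contradiction (injective (Fin1 (from 0#) (from 1#))) 0≢1
  where
  open Field K
  open Inverse index using (from; strictlyInverseˡ)
  Fin1 : (i j : Fin 1) → i ≡ j
  Fin1 zero zero = refl
  injective : from 0# ≡ from 1# → 0# ≡ 1#
  injective eq = trans (sym (strictlyInverseˡ 0#)) (trans (cong (Inverse.to index) eq) (strictlyInverseˡ 1#))
card≥2 {suc (suc n)} K = n , refl

module _ {q : ℕ} (F : FiniteField q) where
  open Field F

  x^card^r≡x : ∀ r x → x ^ (q ℕ.^ r) ≡ x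
  x^card^r≡x zero x = *-identityʳ x
  x^card^r≡x (suc r) x = trans (sym (×-assocˡ x q (q ℕ.^ r)))
    (trans (x^card≡x (x ^ (q ℕ.^ r))) (x^card^r≡x r x))
    where open Mult (CommutativeRing.*-monoid ring) using (×-assocˡ)

subfield : ∀ {q r} → IsPrimePower q → (F : FiniteField q) (K : FiniteField (q ℕ.^ r)) →
  Σ (FiniteField.Carrier F → FiniteField.Carrier K) (IsFieldHom F K)
subfield {q} {r} (p , k , p-prime , _ , q≡p^k) F K = embed p p-prime K
    (Characteristic.p·1≡0 F p k (trans (cong (F._· F.1#) (sym q≡p^k)) F.card·1≡0))
    (Characteristic.p·1≡0 K p (k ℕ.* r) (trans (cong (K._· K.1#) (sym (trans (cong (ℕ._^ r) q≡p^k) (ℕₚ.^-*-assoc p k r)))) K.card·1≡0))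
    (x^card^r≡x F r)
  where
  module F = Field F
  module K = Field K
  -- With a variable `Q` in place of `q ^ r`, the equation from `card≥2` can be matched with `refl`;
  -- likewise `p` is exposed as a successor for `prime-isGraph`.
  embed : ∀ {Q} p → Prime p → (K : FiniteField Q) → p F.· F.1# ≡ F.0# → Field._·_ K p (Field.1# K) ≡ Field.0# K →
    (∀ x → x F.^ Q ≡ x) → Σ (F.Carrier → FiniteField.Carrier K) (IsFieldHom F K)
  embed zero p-prime _ _ _ _ = contradiction p-prime ¬prime[0]
  embed (suc p) p-prime K pF pK fermat with card≥2 K
  ... | Q , refl = embedding fermat
    (_ , prime-isGraph p (pairˡ , pairʳ) λ n n≡0 → trans (proj₂-· n)
       (Characteristic.multiple·1≡0 K {suc p} {n} pK
         (Characteristic.vanishing⇒multiple F {suc p} {n} p-prime pF (trans (sym (proj₁-· n)) n≡0))))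
    where
    open Embedding F K
    open CommutativeRing R using (1#; +-monoid)
    open Mult +-monoid using () renaming (_×_ to _·_)
    proj₁-· : ∀ n → proj₁ (n · 1#) ≡ n F.· F.1#
    proj₁-· zero = refl
    proj₁-· (suc n) = cong (F.1# F.+_) (proj₁-· n)
    proj₂-· : ∀ n → proj₂ (n · 1#) ≡ Field._·_ K n (Field.1# K)
    proj₂-· zero = refl
    proj₂-· (suc n) = cong (Field._+_ K (Field.1# K)) (proj₂-· n)
    pairˡ : proj₁ (suc p · 1#) ≡ F.0#
    pairˡ = trans (proj₁-· (suc p)) pF
    pairʳ : proj₂ (suc p · 1#) ≡ Field.0# K
    pairʳ = trans (proj₂-· (suc p)) pK

-- Bases of field extensions

vec-index : ∀ {q} {A : Set} → Fin q ↔ A → ∀ n → Fin (q ℕ.^ n) ↔ Vec A n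
vec-index {q} {A} α n = mk↔ₛ′ (decode n) encode (decode-encode) (encode-decode n)
  where
  open Inverse α
  decode : ∀ n → Fin (q ℕ.^ n) → Vec A n
  decode zero    _ = []
  decode (suc n) i = to (quotient (q ℕ.^ n) i) ∷ decode n (remainder {q} (q ℕ.^ n) i)
  encode : ∀ {n} → Vec A n → Fin (q ℕ.^ n)
  encode []      = zero
  encode (a ∷ v) = combine (from a) (encode v)
  decode-encode : ∀ {n} (v : Vec A n) → decode n (encode v) ≡ v
  decode-encode [] = refl
  decode-encode {suc n} (a ∷ v) = trans
    (cong (λ (i , j) → to i ∷ decode n j) (Finₚ.remQuot-combine {q} (from a) (encode v)))
    (cong₂ _∷_ (strictlyInverseˡ a) (decode-encode v))
  encode-decode : ∀ n i → encode (decode n i) ≡ i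
  encode-decode zero zero = refl
  encode-decode (suc n) i = trans
    (cong₂ combine (strictlyInverseʳ _) (encode-decode n (remainder {q} (q ℕ.^ n) i)))
    (Finₚ.combine-remQuot {q} (q ℕ.^ n) i)

injection⇒≤ : ∀ {m n} {A B : Set} → Fin m ↔ A → Fin n ↔ B → (f : A → B) → (∀ x y → f x ≡ f y → x ≡ y) → m ℕ.≤ n
injection⇒≤ α β f f-inj = Finₚ.injective⇒≤ {f = Inverse.from β ∘ f ∘ Inverse.to α} λ eq →
  to-inj α (f-inj _ _ (to-inj (↔-sym β) eq))
  where
  to-inj : ∀ {A B : Set} (α : A ↔ B) {x y} → Inverse.to α x ≡ Inverse.to α y → x ≡ y
  to-inj α {x} {y} eq = trans (sym (Inverse.strictlyInverseʳ α x)) (trans (cong (Inverse.from α) eq) (Inverse.strictlyInverseʳ α y))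

module Extension {q Q : ℕ} (F : FiniteField q) (K : FiniteField Q)
  (φ : FiniteField.Carrier F → FiniteField.Carrier K) (φ-hom : IsFieldHom F K φ) where
  private
    module F = Field F
  open Field K
  open IsFieldHom φ-hom
  open ≡-Reasoning

  0-homo : φ F.0# ≡ 0#
  0-homo = sym (+-cancelˡ (φ F.0#) _ _ (trans (+-identityʳ _) (trans (cong φ (sym (F.+-identityʳ F.0#))) (+-homo _ _))))

  -‿homo : ∀ x → φ (F.- x) ≡ - φ x
  -‿homo x = +-inverseˡ-unique _ _ (trans (sym (+-homo _ _)) (trans (cong φ (F.-‿inverseˡ x)) 0-homo))

  lin : ∀ {n} → Vec Carrier n → Vec F.Carrier n → Carrier
  lin []       []      = 0#
  lin (x ∷ ω) (c ∷ w) = φ c * x + lin ω w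

  lin-+ : ∀ {n} (ω : Vec Carrier n) v w → lin ω (Vec.zipWith F._+_ v w) ≡ lin ω v + lin ω w
  lin-+ [] [] [] = sym (+-identityʳ 0#)
  lin-+ (x ∷ ω) (c ∷ v) (d ∷ w) = begin
    φ (c F.+ d) * x + lin ω (Vec.zipWith F._+_ v w) ≡⟨ cong₂ (λ a b → a * x + b) (+-homo c d) (lin-+ ω v w) ⟩
    (φ c + φ d) * x + (lin ω v + lin ω w)
      ≡⟨ Solver.solve 5 (λ c d x p q → (c :+ d) :* x :+ (p :+ q) := (c :* x :+ p) :+ (d :* x :+ q)) refl
           (φ c) (φ d) x (lin ω v) (lin ω w) ⟩
    φ c * x + lin ω v + (φ d * x + lin ω w) ∎
    where open Solver using (_:*_; _:+_; _:=_)

  lin-* : ∀ {n} (ω : Vec Carrier n) c w → lin ω (Vec.map (c F.*_) w) ≡ φ c * lin ω w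
  lin-* [] c [] = sym (zeroʳ (φ c))
  lin-* (x ∷ ω) c (d ∷ w) = begin
    φ (c F.* d) * x + lin ω (Vec.map (c F.*_) w) ≡⟨ cong₂ (λ a b → a * x + b) (*-homo c d) (lin-* ω c w) ⟩
    φ c * φ d * x + φ c * lin ω w
      ≡⟨ Solver.solve 4 (λ c d x p → c :* d :* x :+ c :* p := c :* (d :* x :+ p)) refl (φ c) (φ d) x (lin ω w) ⟩
    φ c * (φ d * x + lin ω w) ∎
    where open Solver using (_:*_; _:+_; _:=_)

  Independent : ∀ {n} → Vec Carrier n → Set
  Independent ω = ∀ v w → lin ω v ≡ lin ω w → v ≡ w

  Spanning : ∀ {n} → Vec Carrier n → Set
  Spanning {n} ω = ∀ x → Σ (Vec F.Carrier n) λ w → lin ω w ≡ x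

  -- If the two coefficients of `x` agree, they cancel; if they differ, dividing the relation by
  -- their difference would put `x` in the span of `ω`.
  independent-∷ : ∀ {n} (ω : Vec Carrier n) {x} → Independent ω → ¬ Σ (Vec F.Carrier n) (λ w → lin ω w ≡ x) →
    Independent (x ∷ ω)
  independent-∷ ω {x} ind x∉span (c ∷ v) (d ∷ w) eq with c F.≟ d
  ... | yes refl = cong (c ∷_) (ind v w (+-cancelˡ (φ c * x) _ _ eq))
  ... | no c≢d with e , c-d*e≡1 ← F.inverse (c F.+ F.- d) (c≢d ∘ F.x-y≡0⇒x≡y) =
    contradiction (Vec.map (e F.*_) (Vec.zipWith F._+_ w (Vec.map (F.- F.1# F.*_) v)) , (begin
      lin ω (Vec.map (e F.*_) (Vec.zipWith F._+_ w (Vec.map (F.- F.1# F.*_) v)))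
        ≡⟨ trans (lin-* ω e _) (cong (φ e *_) (trans (lin-+ ω w _) (cong (lin ω w +_) (lin-* ω (F.- F.1#) v)))) ⟩
      φ e * (W + φ (F.- F.1#) * V)          ≡⟨ cong (λ z → φ e * (W + z * V)) (trans (-‿homo F.1#) (cong -_ 1-homo)) ⟩
      φ e * (W + - 1# * V)                  ≡⟨ cong (φ e *_) difference ⟩
      φ e * ((φ c + - φ d) * x)             ≡⟨ *-assoc _ _ x ⟨
      φ e * (φ c + - φ d) * x               ≡⟨ cong (λ z → φ e * (φ c + z) * x) (-‿homo d) ⟨
      φ e * (φ c + φ (F.- d)) * x           ≡⟨ cong (λ z → φ e * z * x) (+-homo c (F.- d)) ⟨
      φ e * φ (c F.+ F.- d) * x             ≡⟨ cong (_* x) (*-homo e _) ⟨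
      φ (e F.* (c F.+ F.- d)) * x           ≡⟨ cong (λ z → φ z * x) (trans (F.*-comm e _) c-d*e≡1) ⟩
      φ F.1# * x                            ≡⟨ cong (_* x) 1-homo ⟩
      1# * x                                ≡⟨ *-identityˡ x ⟩
      x                                     ∎)) x∉span
    where
    V W : Carrier
    V = lin ω v
    W = lin ω w
    open Solver using (_:*_; _:+_; _:=_; con)
    -- From φ c x + V ≡ φ d x + W, after adding (- φ d) x + (-1) V to both sides.
    difference : W + - 1# * V ≡ (φ c + - φ d) * x
    difference = begin
      W + - 1# * V                                      ≡⟨ +-identityˡ _ ⟨
      0# + (W + - 1# * V)
        ≡⟨ cong (_+ (W + - 1# * V)) (trans (cong (_* x) (-‿inverseʳ (φ d))) (zeroˡ x)) ⟨
      (φ d + - φ d) * x + (W + - 1# * V)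
        ≡⟨ Solver.solve 6 (λ d d′ x W n V → (d :+ d′) :* x :+ (W :+ n :* V) := (d :* x :+ W) :+ (d′ :* x :+ n :* V)) refl
             (φ d) (- φ d) x W (- 1#) V ⟩
      (φ d * x + W) + (- φ d * x + - 1# * V)            ≡⟨ cong (_+ (- φ d * x + - 1# * V)) eq ⟨
      (φ c * x + V) + (- φ d * x + - 1# * V)
        ≡⟨ Solver.solve 5 (λ c d′ x n V → (c :* x :+ V) :+ (d′ :* x :+ n :* V) := (c :+ d′) :* x :+ (con 1 :+ n) :* V) refl
             (φ c) (- φ d) x (- 1#) V ⟩
      (φ c + - φ d) * x + (1# + - 1#) * V
        ≡⟨ cong ((φ c + - φ d) * x +_) (trans (cong (_* V) (-‿inverseʳ 1#)) (zeroˡ V)) ⟩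
      (φ c + - φ d) * x + 0#                            ≡⟨ +-identityʳ _ ⟩
      (φ c + - φ d) * x                                 ∎

  spanning? : ∀ {n} (ω : Vec Carrier n) → Spanning ω ⊎ Σ Carrier λ x → ¬ Σ (Vec F.Carrier n) (λ w → lin ω w ≡ x)
  spanning? {n} ω with exhaustible _ (λ x → ¬? (exhaustible-Vec F.exhaustible n _ λ w → lin ω w ≟ x))
  ... | yes outside = inj₂ outside
  ... | no none = inj₁ λ x → decidable-stable (exhaustible-Vec F.exhaustible n _ λ w → lin ω w ≟ x) λ x∉ → none (x , x∉)

  module _ {r} (Q≡q^r : Q ≡ q ℕ.^ r) where

    1<q : 1 ℕ.< q
    1<q with card≥2 F
    ... | n , refl = s≤s (s≤s z≤n)

    -- Dimension is measured by counting: `lin ω` injects a set of `q ^ n` elements into one of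
    -- `q ^ r`.
    independent⇒≤ : ∀ {n} (ω : Vec Carrier n) → Independent ω → n ℕ.≤ r
    independent⇒≤ {n} ω ind = ℕₚ.≮⇒≥ λ r<n → ℕₚ.<⇒≱ (ℕₚ.^-monoʳ-< q 1<q r<n)
      (subst (q ℕ.^ n ℕ.≤_) Q≡q^r (injection⇒≤ (vec-index F.index n) index (lin ω) ind))

    spanning⇒≥ : ∀ {n} (ω : Vec Carrier n) → Spanning ω → r ℕ.≤ n
    spanning⇒≥ {n} ω span = ℕₚ.≮⇒≥ λ n<r → ℕₚ.<⇒≱ (ℕₚ.^-monoʳ-< q 1<q n<r)
      (subst (ℕ._≤ q ℕ.^ n) Q≡q^r (injection⇒≤ index (vec-index F.index n) (proj₁ ∘ span)
        λ x y eq → trans (sym (proj₂ (span x))) (trans (cong (lin ω) eq) (proj₂ (span y)))))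

    basis : Σ (Vec Carrier r) λ ω → Independent ω × Spanning ω
    basis = grow r [] (λ { [] [] _ → refl }) (ℕₚ.+-identityʳ r)
      where
      -- `fuel` is `r` minus the current length; when it runs out, a vector outside the span would
      -- make `suc r` independent ones.
      grow : ∀ fuel {n} (ω : Vec Carrier n) → Independent ω → fuel ℕ.+ n ≡ r →
        Σ (Vec Carrier r) λ ω → Independent ω × Spanning ω
      grow fuel ω ind fuel+n≡r with spanning? ω
      grow fuel {n} ω ind fuel+n≡r | inj₁ span with ℕₚ.≤-antisym (independent⇒≤ ω ind) (spanning⇒≥ ω span)
      ... | refl = ω , ind , span
      grow zero ω ind refl | inj₂ (x , x∉) = contradiction (independent⇒≤ (x ∷ ω) (independent-∷ ω ind x∉)) ℕₚ.1+n≰n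
      grow (suc fuel) {n} ω ind fuel+n≡r | inj₂ (x , x∉) =
        grow fuel (x ∷ ω) (independent-∷ ω ind x∉) (trans (ℕₚ.+-suc fuel n) fuel+n≡r)

-- Counting

open CMSum ℕₚ.+-0-commutativeMonoid using () renaming
  ( sum to sumℕ; sum-cong-≗ to sumℕ-cong; sum-replicate to sumℕ-replicate; sum-replicate-zero to sumℕ-replicate-zero
  ; ∑-distrib-+ to sumℕ-distrib-+; ∑-comm to sumℕ-comm )

indicator : Bool → ℕ
indicator b = if b then 1 else 0

count-suc : ∀ N P → count (suc N) P ≡ indicator (P N) ℕ.+ count N P
count-suc N P with P N
... | true = refl
... | false = refl

count-cong : ∀ N {P P′ : ℕ → Bool} → (∀ n → P n ≡ P′ n) → count N P ≡ count N P′
count-cong zero P≡P′ = refl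
count-cong (suc N) {P} {P′} P≡P′ = trans (count-suc N P)
  (trans (cong₂ ℕ._+_ (cong indicator (P≡P′ N)) (count-cong N P≡P′)) (sym (count-suc N P′)))

count>0⇒∃ : ∀ N (P : ℕ → Bool) → 0 ℕ.< count N P → Σ ℕ λ n → P n ≡ true
count>0⇒∃ (suc N) P count>0 with P N in eq
... | true = N , eq
... | false = count>0⇒∃ N P count>0

count-+ : ∀ a b P → count (a ℕ.+ b) P ≡ count a P ℕ.+ count b (λ n → P (a ℕ.+ n))
count-+ a zero P = trans (cong (λ n → count n P) (ℕₚ.+-identityʳ a)) (sym (ℕₚ.+-identityʳ _))
count-+ a (suc b) P = begin
  count (a ℕ.+ suc b) P                          ≡⟨ cong (λ n → count n P) (ℕₚ.+-suc a b) ⟩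
  count (suc (a ℕ.+ b)) P                        ≡⟨ count-suc (a ℕ.+ b) P ⟩
  i ℕ.+ count (a ℕ.+ b) P                        ≡⟨ cong (i ℕ.+_) (count-+ a b P) ⟩
  i ℕ.+ (count a P ℕ.+ count b P′)               ≡⟨ ℕₚ.+-assoc i (count a P) _ ⟨
  (i ℕ.+ count a P) ℕ.+ count b P′               ≡⟨ cong (ℕ._+ count b P′) (ℕₚ.+-comm i (count a P)) ⟩
  (count a P ℕ.+ i) ℕ.+ count b P′               ≡⟨ ℕₚ.+-assoc (count a P) i _ ⟩
  count a P ℕ.+ (i ℕ.+ count b P′)               ≡⟨ cong (count a P ℕ.+_) (count-suc b P′) ⟨
  count a P ℕ.+ count (suc b) P′                 ∎
  where
  open ≡-Reasoning
  i : ℕ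
  i = indicator (P (a ℕ.+ b))
  P′ : ℕ → Bool
  P′ n = P (a ℕ.+ n)

count-sum : ∀ N P → count N P ≡ sumℕ {N} (λ i → indicator (P (toℕ i)))
count-sum zero P = refl
count-sum (suc N) P = trans (count-+ 1 N P) (cong₂ ℕ._+_
  (trans (count-suc 0 P) (ℕₚ.+-identityʳ _)) (count-sum N (P ∘ suc)))

-- Sorts the numbers by their lowest base-`q` digit, which is the induction step of
-- `count-digitVec`.
count-residues : ∀ N q P → count (N ℕ.* q) P ≡ sumℕ {q} (λ c → count N (λ n → P (toℕ c ℕ.+ n ℕ.* q)))
count-residues zero q P = sym (sumℕ-replicate-zero q)
count-residues (suc N) q P = begin
  count (q ℕ.+ N ℕ.* q) P                          ≡⟨ cong (λ n → count n P) (ℕₚ.+-comm q (N ℕ.* q)) ⟩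
  count (N ℕ.* q ℕ.+ q) P                          ≡⟨ count-+ (N ℕ.* q) q P ⟩
  count (N ℕ.* q) P ℕ.+ count q (λ n → P (N ℕ.* q ℕ.+ n)) ≡⟨ ℕₚ.+-comm (count (N ℕ.* q) P) _ ⟩
  count q (λ n → P (N ℕ.* q ℕ.+ n)) ℕ.+ count (N ℕ.* q) P
    ≡⟨ cong₂ ℕ._+_ (trans (count-sum q _) (sumℕ-cong {q} λ c → cong (indicator ∘ P) (ℕₚ.+-comm (N ℕ.* q) (toℕ c))))
         (count-residues N q P) ⟩
  sumℕ {q} (λ c → indicator (P (toℕ c ℕ.+ N ℕ.* q))) ℕ.+ sumℕ {q} (λ c → count N (λ n → P (toℕ c ℕ.+ n ℕ.* q)))
    ≡⟨ sumℕ-distrib-+ {q} (λ c → indicator (P (toℕ c ℕ.+ N ℕ.* q))) (λ c → count N (λ n → P (toℕ c ℕ.+ n ℕ.* q))) ⟨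
  sumℕ {q} (λ c → indicator (P (toℕ c ℕ.+ N ℕ.* q)) ℕ.+ count N (λ n → P (toℕ c ℕ.+ n ℕ.* q)))
    ≡⟨ sumℕ-cong {q} (λ c → count-suc N (λ n → P (toℕ c ℕ.+ n ℕ.* q))) ⟨
  sumℕ {q} (λ c → count (suc N) (λ n → P (toℕ c ℕ.+ n ℕ.* q)))  ∎
  where open ≡-Reasoning

-- Base-q digits

module _ (q : ℕ) .{{_ : NonZero q}} where

  digit-zero : ∀ (c : Fin q) n → digit q 0 (toℕ c ℕ.+ n ℕ.* q) ≡ c
  digit-zero c n = Finₚ.toℕ-injective (begin
    toℕ (((toℕ c ℕ.+ n ℕ.* q) / 1) mod q) ≡⟨ Finₚ.toℕ-fromℕ< _ ⟩
    ((toℕ c ℕ.+ n ℕ.* q) / 1) % q         ≡⟨ cong (_% q) (n/1≡n _) ⟩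
    (toℕ c ℕ.+ n ℕ.* q) % q               ≡⟨ [m+kn]%n≡m%n (toℕ c) n q ⟩
    toℕ c % q                             ≡⟨ m<n⇒m%n≡m (Finₚ.toℕ<n c) ⟩
    toℕ c                                 ∎)
    where open ≡-Reasoning

  digit-suc : ∀ (c : Fin q) n k → digit q (suc k) (toℕ c ℕ.+ n ℕ.* q) ≡ digit q k n
  digit-suc c n k = cong (_mod q) (begin
    (toℕ c ℕ.+ n ℕ.* q) / (q ℕ.* q ℕ.^ k)   ≡⟨ m/n/o≡m/[n*o] (toℕ c ℕ.+ n ℕ.* q) q (q ℕ.^ k) ⟨
    (toℕ c ℕ.+ n ℕ.* q) / q / q ℕ.^ k
      ≡⟨ cong (_/ q ℕ.^ k) (trans (+-distrib-/-∣ʳ (toℕ c) (n∣m*n n))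
           (cong₂ ℕ._+_ (m<n⇒m/n≡0 (Finₚ.toℕ<n c)) (m*n/n≡m n q))) ⟩
    n / q ℕ.^ k                             ∎)
    where
    open ≡-Reasoning
    instance
      _ = ℕₚ.m^n≢0 q k
      _ = ℕₚ.m^n≢0 q (suc k)

module VectorSums {q : ℕ} {A : Set} (α : Fin q ↔ A) where

  sumA : (A → ℕ) → ℕ
  sumA f = sumℕ (f ∘ Inverse.to α)

  sumV : ∀ m → (Vec A m → ℕ) → ℕ
  sumV zero    f = f []
  sumV (suc m) f = sumA λ a → sumV m λ v → f (a ∷ v)

  sumV-cong : ∀ m {f g : Vec A m → ℕ} → (∀ v → f v ≡ g v) → sumV m f ≡ sumV m g
  sumV-cong zero    f≡g = f≡g []
  sumV-cong (suc m) f≡g = sumℕ-cong {q} λ i → sumV-cong m λ v → f≡g (Inverse.to α i ∷ v)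

  sumV-const : ∀ m c → sumV m (λ _ → c) ≡ q ℕ.^ m ℕ.* c
  sumV-const zero c = sym (ℕₚ.+-identityʳ c)
  sumV-const (suc m) c = trans (sumℕ-cong {q} λ _ → sumV-const m c)
    (trans (sumℕ-replicate q) (trans (×≡* q _) (sym (ℕₚ.*-assoc q (q ℕ.^ m) c))))
    where
    open Mult ℕₚ.+-0-monoid using () renaming (_×_ to _·_)
    ×≡* : ∀ n x → n · x ≡ n ℕ.* x
    ×≡* zero x = refl
    ×≡* (suc n) x = cong (x ℕ.+_) (×≡* n x)

  sum-sumV-comm : ∀ {n} k (g : Fin n → Vec A k → ℕ) → sumℕ (λ i → sumV k (g i)) ≡ sumV k (λ w → sumℕ (λ i → g i w))
  sum-sumV-comm zero g = refl
  sum-sumV-comm (suc k) g = trans (sumℕ-comm (λ i j → sumV k λ w → g i (Inverse.to α j ∷ w)))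
    (sumℕ-cong {q} λ j → sum-sumV-comm k (λ i w → g i (Inverse.to α j ∷ w)))

  sumV-comm : ∀ m k (g : Vec A m → Vec A k → ℕ) → sumV m (λ v → sumV k (g v)) ≡ sumV k (λ w → sumV m (λ v → g v w))
  sumV-comm zero k g = refl
  sumV-comm (suc m) k g = trans (sumℕ-cong {q} λ i → sumV-comm m k λ v → g (Inverse.to α i ∷ v))
    (sum-sumV-comm k λ i w → sumV m λ v → g (Inverse.to α i ∷ v) w)

  digitVec : .{{_ : NonZero q}} → ∀ {m} → (Fin m → Fin q ↔ A) → ℕ → Vec A m
  digitVec η n = Vec.tabulate λ r → Inverse.to (η r) (digit q (toℕ r) n)

  -- Each digit is read through its own bijection; after summation over that digit, `sum-↔` turns it
  -- into the common enumeration `α`.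
  count-digitVec : .{{_ : NonZero q}} → ∀ {m} (η : Fin m → Fin q ↔ A) (P : Vec A m → Bool) →
    count (q ℕ.^ m) (P ∘ digitVec η) ≡ sumV m (indicator ∘ P)
  count-digitVec {zero} η P = trans (count-suc 0 (P ∘ digitVec η)) (ℕₚ.+-identityʳ _)
  count-digitVec {suc m} η P = begin
    count (q ℕ.* q ℕ.^ m) (P ∘ digitVec η)    ≡⟨ cong (λ N → count N (P ∘ digitVec η)) (ℕₚ.*-comm q (q ℕ.^ m)) ⟩
    count (q ℕ.^ m ℕ.* q) (P ∘ digitVec η)    ≡⟨ count-residues (q ℕ.^ m) q (P ∘ digitVec η) ⟩
    sumℕ {q} (λ c → count (q ℕ.^ m) (λ n → P (digitVec η (toℕ c ℕ.+ n ℕ.* q))))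
      ≡⟨ sumℕ-cong {q} (λ c → count-cong (q ℕ.^ m) λ n → cong P (digitVec-∷ c n)) ⟩
    sumℕ {q} (λ c → count (q ℕ.^ m) (λ n → P (Inverse.to (η zero) c ∷ digitVec (η ∘ suc) n)))
      ≡⟨ sumℕ-cong {q} (λ c → count-digitVec (η ∘ suc) (P ∘ (Inverse.to (η zero) c ∷_))) ⟩
    sumℕ {q} (λ c → sumV m (λ v → indicator (P (Inverse.to (η zero) c ∷ v))))
      ≡⟨ sum-↔ ℕₚ.+-0-commutativeMonoid (λ a → sumV m (λ v → indicator (P (a ∷ v)))) (η zero) α ⟩
    sumV (suc m) (indicator ∘ P)              ∎
    where
    open ≡-Reasoning
    digitVec-∷ : ∀ c n → digitVec η (toℕ c ℕ.+ n ℕ.* q) ≡ Inverse.to (η zero) c ∷ digitVec (η ∘ suc) n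
    digitVec-∷ c n = cong₂ _∷_ (cong (Inverse.to (η zero)) (digit-zero q c n))
      (Vecₚ.tabulate-cong λ r → cong (Inverse.to (η (suc r))) (digit-suc q c n (toℕ r)))

-- Fibres of additive maps

module LinearFibres {Q : ℕ} (K : FiniteField Q) where
  open Field K
  open VectorSums index public

  infixl 6 _+ᵥ_
  _+ᵥ_ : ∀ {m} → Vec Carrier m → Vec Carrier m → Vec Carrier m
  _+ᵥ_ = Vec.zipWith _+_

  sumV-translate : ∀ m (f : Vec Carrier m → ℕ) u → sumV m (λ v → f (v +ᵥ u)) ≡ sumV m f
  sumV-translate zero f [] = refl
  sumV-translate (suc m) f (b ∷ u) = trans
    (sumℕ-cong {Q} λ i → sumV-translate m (λ v → f (Inverse.to index i + b ∷ v)) u)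
    (sum-↔ ℕₚ.+-0-commutativeMonoid (λ a → sumV m λ v → f (a ∷ v)) (translate b ↔-∘ index) index)

  infix 4 _==_
  _==_ : ∀ {m} → Vec Carrier m → Vec Carrier m → Bool
  []      == []      = true
  (a ∷ v) == (b ∷ w) = does (a ≟ b) ∧ (v == w)

  ==⇒≡ : ∀ {m} (v w : Vec Carrier m) → (v == w) ≡ true → v ≡ w
  ==⇒≡ [] [] _ = refl
  ==⇒≡ (a ∷ v) (b ∷ w) eq with a ≟ b
  ... | yes refl = cong (a ∷_) (==⇒≡ v w eq)

  ==-refl : ∀ {m} (v : Vec Carrier m) → (v == v) ≡ true
  ==-refl [] = refl
  ==-refl (a ∷ v) rewrite dec-true (a ≟ a) refl = ==-refl v

  ==-translate : ∀ {m} (v w u : Vec Carrier m) → (v +ᵥ u == w +ᵥ u) ≡ (v == w)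
  ==-translate [] [] [] = refl
  ==-translate (a ∷ v) (b ∷ w) (c ∷ u) with a ≟ b
  ... | yes refl rewrite dec-true (a + c ≟ a + c) refl = ==-translate v w u
  ... | no a≢b rewrite dec-false (a + c ≟ b + c) (a≢b ∘ +-cancelʳ c a b) = refl

  sumV-== : ∀ {m} (v : Vec Carrier m) → sumV m (λ w → indicator (v == w)) ≡ 1
  sumV-== [] = refl
  sumV-== {suc m} (a ∷ v) = trans
    (sum-single ℕₚ.+-0-commutativeMonoid (from a) _ λ j j≢ → other (to j) λ a≡ → j≢ (trans (sym (strictlyInverseʳ j)) (cong from (sym a≡))))
    (same (to (from a)) (sym (strictlyInverseˡ a)))
    where
    open Inverse index using (to; from; strictlyInverseˡ; strictlyInverseʳ)
    other : ∀ b → a ≢ b → sumV m (λ w → indicator (does (a ≟ b) ∧ (v == w))) ≡ 0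
    other b a≢b rewrite dec-false (a ≟ b) a≢b = trans (sumV-const m 0) (ℕₚ.*-zeroʳ (Q ℕ.^ m))
    same : ∀ b → a ≡ b → sumV m (λ w → indicator (does (a ≟ b) ∧ (v == w))) ≡ 1
    same b a≡b rewrite dec-true (a ≟ b) a≡b = sumV-== v

  difference : ∀ {k} (w w′ : Vec Carrier k) → Σ (Vec Carrier k) λ u → w +ᵥ u ≡ w′
  difference [] [] = [] , refl
  difference (a ∷ w) (b ∷ w′) with u , w+u≡w′ ← difference w w′ =
    - a + b ∷ u , cong₂ _∷_ (trans (sym (+-assoc a (- a) b)) (trans (cong (_+ b) (-‿inverseʳ a)) (+-identityˡ b))) w+u≡w′

  -- All fibres of a surjective additive map are translates of each other.
  fibre-card : ∀ {m k} (f : Vec Carrier m → Vec Carrier k) → (∀ v u → f (v +ᵥ u) ≡ f v +ᵥ f u) →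
    (∀ w → Σ (Vec Carrier m) λ v → f v ≡ w) →
    ∀ w → Q ℕ.^ k ℕ.* sumV m (λ v → indicator (f v == w)) ≡ Q ℕ.^ m
  fibre-card {m} {k} f f-+ f-surj w = begin
    Q ℕ.^ k ℕ.* fibre w                               ≡⟨ sumV-const k (fibre w) ⟨
    sumV k (λ _ → fibre w)                            ≡⟨ sumV-cong k (λ w′ → fibre-const w′) ⟩
    sumV k fibre                                      ≡⟨ sumV-comm k m (λ w′ v → indicator (f v == w′)) ⟩
    sumV m (λ v → sumV k (λ w′ → indicator (f v == w′))) ≡⟨ sumV-cong m (λ v → sumV-== (f v)) ⟩
    sumV m (λ _ → 1)                                  ≡⟨ sumV-const m 1 ⟩
    Q ℕ.^ m ℕ.* 1                                     ≡⟨ ℕₚ.*-identityʳ _ ⟩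
    Q ℕ.^ m                                           ∎
    where
    open ≡-Reasoning
    fibre : Vec Carrier k → ℕ
    fibre w = sumV m (λ v → indicator (f v == w))
    fibre-const : ∀ w′ → fibre w ≡ fibre w′
    fibre-const w′ with u , w+u≡w′ ← difference w w′ with v₀ , fv₀≡u ← f-surj u = begin
      fibre w                                             ≡⟨ sumV-cong m (λ v → cong indicator (==-translate (f v) w u)) ⟨
      sumV m (λ v → indicator (f v +ᵥ u == w +ᵥ u))
        ≡⟨ sumV-cong m (λ v → cong₂ (λ a b → indicator (a == b)) (trans (cong (f v +ᵥ_) (sym fv₀≡u)) (sym (f-+ v v₀))) w+u≡w′) ⟩
      sumV m (λ v → indicator (f (v +ᵥ v₀) == w′))        ≡⟨ sumV-translate m (λ v → indicator (f v == w′)) v₀ ⟩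
      fibre w′                                            ∎

-- Elementary intervals and leading digits

module _ (q : ℕ) where
  open import Data.Nat using (_+_; _*_; _^_)

  value : (m : ℕ) → (Fin m → Fin q) → ℕ
  value m x = Σℕ m λ j → toℕ (x j) * q ^ (m ∸ suc (toℕ j))

  -- This is the `a` of the elementary interval holding the points that begin with these `d` digits.
  -- The clause with no digits left is a default for `d` above `m`.
  prefix : (d : ℕ) {m : ℕ} → (Fin m → Fin q) → ℕ
  prefix zero    x = 0
  prefix (suc d) {zero}  x = 0
  prefix (suc d) {suc m} x = toℕ (x zero) * q ^ d + prefix d (x ∘ suc)

  leading-digit : ∀ {B X} c → X < B → c * B + X < suc c * B
  leading-digit {B} {X} c X<B = subst (c * B + X <_) (ℕₚ.+-comm (c * B) B) (ℕₚ.+-monoʳ-< (c * B) X<B)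

  value< : ∀ m x → value m x < q ^ m
  value< zero x = s≤s z≤n
  value< (suc m) x = ℕₚ.<-≤-trans (leading-digit (toℕ (x zero)) (value< m (x ∘ suc)))
    (ℕₚ.*-monoˡ-≤ (q ^ m) (Finₚ.toℕ<n (x zero)))

  prefix< : ∀ d {m} (x : Fin m → Fin q) → d ≤ m → prefix d x < q ^ d
  prefix< zero x d≤m = s≤s z≤n
  prefix< (suc d) {suc m} x (s≤s d≤m) = ℕₚ.<-≤-trans (leading-digit (toℕ (x zero)) (prefix< d (x ∘ suc) d≤m))
    (ℕₚ.*-monoˡ-≤ (q ^ d) (Finₚ.toℕ<n (x zero)))

  prefix-surjective : ∀ d {m} .{{_ : NonZero q}} a → d ≤ m → a < q ^ d → Σ (Fin m → Fin q) λ x → prefix d x ≡ a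
  prefix-surjective zero {m} zero d≤m a<1 = (λ _ → fromℕ< (ℕ.>-nonZero⁻¹ q)) , refl
  prefix-surjective zero (suc a) d≤m (s≤s ())
  prefix-surjective (suc d) a (s≤s {n = m} d≤m) a<q^d
    with x , eq ← prefix-surjective d {m} ((a % q ^ d) {{ℕₚ.m^n≢0 q d}}) d≤m (m%n<n a (q ^ d) {{ℕₚ.m^n≢0 q d}}) =
    y , (begin
      toℕ (fromℕ< a/q^d<q) * q ^ d + prefix d x  ≡⟨ cong₂ (λ b c → b * q ^ d + c) (Finₚ.toℕ-fromℕ< a/q^d<q) eq ⟩
      a / q ^ d * q ^ d + a % q ^ d              ≡⟨ ℕₚ.+-comm (a / q ^ d * q ^ d) _ ⟩
      a % q ^ d + a / q ^ d * q ^ d              ≡⟨ m≡m%n+[m/n]*n a (q ^ d) ⟨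
      a                                          ∎)
    where
    open ≡-Reasoning
    instance
      _ = ℕₚ.m^n≢0 q d
    a/q^d<q : a / q ^ d < q
    a/q^d<q = m<n*o⇒m/o<n a<q^d
    y : Fin (suc m) → Fin q
    y zero    = fromℕ< a/q^d<q
    y (suc j) = x j

  Between : (m d a X : ℕ) → Set
  Between m d a X = a * q ^ (m ∸ d) ≤ X × X < suc a * q ^ (m ∸ d)

  -- Separates the leading digit `c` from an interval endpoint, so that both comparisons reduce to
  -- one digit less.
  prefix-shift : ∀ {d m} → d ≤ m → ∀ c p → (c * q ^ d + p) * q ^ (m ∸ d) ≡ c * q ^ m + p * q ^ (m ∸ d)
  prefix-shift {d} {m} d≤m c p = begin
    (c * q ^ d + p) * q ^ (m ∸ d)               ≡⟨ ℕₚ.*-distribʳ-+ (q ^ (m ∸ d)) (c * q ^ d) p ⟩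
    c * q ^ d * q ^ (m ∸ d) + p * q ^ (m ∸ d)   ≡⟨ cong (_+ p * q ^ (m ∸ d)) (ℕₚ.*-assoc c _ _) ⟩
    c * (q ^ d * q ^ (m ∸ d)) + p * q ^ (m ∸ d) ≡⟨ cong (λ z → c * z + p * q ^ (m ∸ d)) (ℕₚ.^-distribˡ-+-* q d (m ∸ d)) ⟨
    c * q ^ (d + (m ∸ d)) + p * q ^ (m ∸ d)     ≡⟨ cong (λ z → c * q ^ z + p * q ^ (m ∸ d)) (ℕₚ.m+[n∸m]≡n d≤m) ⟩
    c * q ^ m + p * q ^ (m ∸ d)                 ∎
    where open ≡-Reasoning

  Agree : ∀ d {m} → (Fin m → Fin q) → (Fin m → Fin q) → Set
  Agree d x y = ∀ j → toℕ j < d → x j ≡ y j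

  agree⇒between : ∀ {d m} → d ≤ m → (x y : Fin m → Fin q) → Agree d x y → Between m d (prefix d y) (value m x)
  agree⇒between {m = m} z≤n x y agree = z≤n , subst (value m x <_) (sym (ℕₚ.*-identityˡ (q ^ m))) (value< m x)
  agree⇒between {suc d} {suc m} (s≤s d≤m) x y agree
    with lower , upper ← agree⇒between d≤m (x ∘ suc) (y ∘ suc) (λ j j<d → agree (suc j) (s≤s j<d))
    rewrite agree zero (s≤s z≤n) =
      subst (_≤ c * q ^ m + X) (sym (prefix-shift d≤m c p)) (ℕₚ.+-monoʳ-≤ (c * q ^ m) lower) ,
      subst (c * q ^ m + X <_)
        (sym (trans (cong (_* q ^ (m ∸ d)) (sym (ℕₚ.+-suc (c * q ^ d) p))) (prefix-shift d≤m c (suc p))))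
        (ℕₚ.+-monoʳ-< (c * q ^ m) upper)
    where
    c p X : ℕ
    c = toℕ (y zero)
    p = prefix d (y ∘ suc)
    X = value m (x ∘ suc)

  -- The interval lies inside the block of length q^m belonging to its leading digit, and blocks of
  -- different leading digits are disjoint, so the leading digits agree. After cancelling c q^m the
  -- tails are in the same situation.
  between⇒agree : ∀ {d m} → d ≤ m → (x y : Fin m → Fin q) → Between m d (prefix d y) (value m x) → Agree d x y
  between⇒agree z≤n x y _ j ()
  between⇒agree {suc d} {suc m} (s≤s d≤m) x y (lower , upper) = agree
    where
    b c p X : ℕ
    b = toℕ (x zero)
    c = toℕ (y zero)
    p = prefix d (y ∘ suc)
    X = value m (x ∘ suc)
    lower′ : c * q ^ m + p * q ^ (m ∸ d) ≤ b * q ^ m + X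
    lower′ = subst (_≤ b * q ^ m + X) (prefix-shift d≤m c p) lower
    upper′ : b * q ^ m + X < c * q ^ m + suc p * q ^ (m ∸ d)
    upper′ = subst (b * q ^ m + X <_)
      (trans (cong (_* q ^ (m ∸ d)) (sym (ℕₚ.+-suc (c * q ^ d) p))) (prefix-shift d≤m c (suc p))) upper
    head≡ : x zero ≡ y zero
    head≡ = Finₚ.toℕ-injective (ℕₚ.≤-antisym
      (ℕₚ.≮⇒≥ λ c<b → ℕₚ.<⇒≱ upper′ (begin
        c * q ^ m + suc p * q ^ (m ∸ d)    ≤⟨ ℕₚ.+-monoʳ-≤ (c * q ^ m) (begin
          suc p * q ^ (m ∸ d)              ≤⟨ ℕₚ.*-monoˡ-≤ (q ^ (m ∸ d)) (prefix< d (y ∘ suc) d≤m) ⟩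
          q ^ d * q ^ (m ∸ d)              ≡⟨ ℕₚ.^-distribˡ-+-* q d (m ∸ d) ⟨
          q ^ (d + (m ∸ d))                ≡⟨ cong (q ^_) (ℕₚ.m+[n∸m]≡n d≤m) ⟩
          q ^ m                            ∎) ⟩
        c * q ^ m + q ^ m                  ≡⟨ ℕₚ.+-comm (c * q ^ m) (q ^ m) ⟩
        suc c * q ^ m                      ≤⟨ ℕₚ.*-monoˡ-≤ (q ^ m) c<b ⟩
        b * q ^ m                          ≤⟨ ℕₚ.m≤m+n (b * q ^ m) X ⟩
        b * q ^ m + X                      ∎))
      (ℕₚ.≮⇒≥ λ b<c → ℕₚ.<⇒≱ (leading-digit b (value< m (x ∘ suc))) (begin
        suc b * q ^ m                      ≤⟨ ℕₚ.*-monoˡ-≤ (q ^ m) b<c ⟩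
        c * q ^ m                          ≤⟨ ℕₚ.m≤m+n (c * q ^ m) _ ⟩
        c * q ^ m + p * q ^ (m ∸ d)        ≤⟨ lower′ ⟩
        b * q ^ m + X                      ∎)))
      where open ℕₚ.≤-Reasoning
    b≡c : b ≡ c
    b≡c = cong toℕ head≡
    agree : Agree (suc d) x y
    agree zero _ = head≡
    agree (suc j) (s≤s j<d) = between⇒agree d≤m (x ∘ suc) (y ∘ suc)
      ( ℕₚ.+-cancelˡ-≤ (c * q ^ m) _ _ (subst (λ z → c * q ^ m + p * q ^ (m ∸ d) ≤ z * q ^ m + X) b≡c lower′)
      , ℕₚ.+-cancelˡ-< (c * q ^ m) _ _ (subst (λ z → z * q ^ m + X < c * q ^ m + suc p * q ^ (m ∸ d)) b≡c upper′))
      j j<d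

  inInterval⇒between : ∀ m d a X → inInterval q m d a X ≡ true → Between m d a X
  inInterval⇒between m d a X eq with p , r ← Equivalence.to T-∧ (Equivalence.from T-≡ eq) =
    ℕₚ.≤ᵇ⇒≤ _ _ p , ℕₚ.<ᵇ⇒< _ _ r

  between⇒inInterval : ∀ m d a X → Between m d a X → inInterval q m d a X ≡ true
  between⇒inInterval m d a X (p , r) =
    Equivalence.to T-≡ (Equivalence.from T-∧ (ℕₚ.≤⇒≤ᵇ p , ℕₚ.<⇒<ᵇ r))

all : ∀ s → (Fin s → Bool) → Bool
all zero    f = true
all (suc s) f = f zero ∧ all s (f ∘ suc)

all⇒∀ : ∀ s {f} → all s f ≡ true → ∀ i → f i ≡ true
all⇒∀ (suc s) {f} eq i with f zero in f0 | all s (f ∘ suc) in fs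
all⇒∀ (suc s) eq zero    | true | true = f0
all⇒∀ (suc s) eq (suc i) | true | true = all⇒∀ s fs i

∀⇒all : ∀ s {f} → (∀ i → f i ≡ true) → all s f ≡ true
∀⇒all zero    f≡true = refl
∀⇒all (suc s) f≡true = cong₂ _∧_ (f≡true zero) (∀⇒all s (f≡true ∘ suc))

bool-ext : ∀ {a b} → (a ≡ true → b ≡ true) → (b ≡ true → a ≡ true) → a ≡ b
bool-ext {true}  to from = sym (to refl)
bool-ext {false} {true} to from = from refl
bool-ext {false} {false} to from = refl

mutual
  -- The conjunction inside IsNet is a private local function; the metavariable here is
  -- solved by unification with it, which gives it a name.
  -- It is lifted over all parameters of IsNet but does not use them, so conversion ignores them;
  -- this is why the recursive call of inBox≡all, at other parameters, has the right type.
  inBox : (b u m s : ℕ) (e : Fin s → ℕ) (X : ℕ → Fin s → ℕ) (d a : Fin s → ℕ) → ℕ → Bool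
  inBox = _

  net-count : ∀ b u m s e X → IsNet b u m s e X → (d a : Fin s → ℕ) →
    (∀ i → a i < b ℕ.^ d i) → (∀ i → e i ∣ d i) → Σℕ s d ℕ.+ u ≤ m →
    count (b ℕ.^ m) (λ n → inBox b u m s e X d a n) ≡ b ℕ.^ (m ∸ Σℕ s d)
  net-count b u m s e X net = proj₂ net

inBox≡all : ∀ b u m s e X d a n → inBox b u m s e X d a n ≡ all s (λ i → inInterval b m (d i) (a i) (X n i))
inBox≡all b u m zero    e X d a n = refl
inBox≡all b u m (suc s) e X d a n = cong (inInterval b m (d zero) (a zero) (X n zero) ∧_)
  (inBox≡all b u m s (e ∘ suc) (λ n → X n ∘ suc) (d ∘ suc) (a ∘ suc) n)

term≤Σℕ : ∀ s (d : Fin s → ℕ) i → d i ≤ Σℕ s d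
term≤Σℕ (suc s) d zero = ℕₚ.m≤m+n _ _
term≤Σℕ (suc s) d (suc i) = ℕₚ.≤-trans (term≤Σℕ s (d ∘ suc) i) (ℕₚ.m≤n+m _ _)

Σℕ-cong : ∀ s {f g : Fin s → ℕ} → (∀ i → f i ≡ g i) → Σℕ s f ≡ Σℕ s g
Σℕ-cong zero    f≡g = refl
Σℕ-cong (suc s) f≡g = cong₂ ℕ._+_ (f≡g zero) (Σℕ-cong s (f≡g ∘ suc))

module Flatten {A : Set} where

  -- Turns prescribing a ragged set of outputs into a fibre of a single map between vector spaces,
  -- to which `fibre-card` applies.
  flatten : ∀ {s m} (d : Fin s → ℕ) → (∀ i → d i ≤ m) → (Fin s → Fin m → A) → Vec A (Σℕ s d)
  flatten {zero}  d d≤m y = []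
  flatten {suc s} d d≤m y = Vec.tabulate (λ j → y zero (inject≤ j (d≤m zero))) ++ flatten (d ∘ suc) (d≤m ∘ suc) (y ∘ suc)

  flatten-cong : ∀ {s m} (d : Fin s → ℕ) (d≤m : ∀ i → d i ≤ m) {y z : Fin s → Fin m → A} →
    (∀ i j → toℕ j < d i → y i j ≡ z i j) → flatten d d≤m y ≡ flatten d d≤m z
  flatten-cong {zero}  d d≤m y≡z = refl
  flatten-cong {suc s} d d≤m y≡z = cong₂ _++_
    (Vecₚ.tabulate-cong λ j → y≡z zero _ (subst (_< d zero) (sym (Finₚ.toℕ-inject≤ j (d≤m zero))) (Finₚ.toℕ<n j)))
    (flatten-cong (d ∘ suc) (d≤m ∘ suc) (y≡z ∘ suc))

  tabulate-inject≤-injective : ∀ {d m} (d≤m : d ≤ m) {y z : Fin m → A} →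
    Vec.tabulate (λ j → y (inject≤ j d≤m)) ≡ Vec.tabulate (λ j → z (inject≤ j d≤m)) → ∀ j → toℕ j < d → y j ≡ z j
  tabulate-inject≤-injective d≤m {y} {z} eq j j<d = begin
    y j                                  ≡⟨ cong y inject ⟨
    y (inject≤ (fromℕ< j<d) d≤m)         ≡⟨ Vecₚ.lookup∘tabulate _ (fromℕ< j<d) ⟨
    Vec.lookup (Vec.tabulate (λ j → y (inject≤ j d≤m))) (fromℕ< j<d) ≡⟨ cong (λ v → Vec.lookup v (fromℕ< j<d)) eq ⟩
    Vec.lookup (Vec.tabulate (λ j → z (inject≤ j d≤m))) (fromℕ< j<d) ≡⟨ Vecₚ.lookup∘tabulate _ (fromℕ< j<d) ⟩
    z (inject≤ (fromℕ< j<d) d≤m)         ≡⟨ cong z inject ⟩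
    z j                                  ∎
    where
    open ≡-Reasoning
    inject : inject≤ (fromℕ< j<d) d≤m ≡ j
    inject = Finₚ.toℕ-injective (trans (Finₚ.toℕ-inject≤ (fromℕ< j<d) d≤m) (Finₚ.toℕ-fromℕ< j<d))

  flatten-injective : ∀ {s m} (d : Fin s → ℕ) (d≤m : ∀ i → d i ≤ m) {y z : Fin s → Fin m → A} →
    flatten d d≤m y ≡ flatten d d≤m z → ∀ i j → toℕ j < d i → y i j ≡ z i j
  flatten-injective {suc s} d d≤m {y} {z} eq with Vecₚ.++-injective (Vec.tabulate (λ j → y zero (inject≤ j (d≤m zero)))) _ eq
  ... | eq₁ , eq₂ = λ where
    zero    → tabulate-inject≤-injective (d≤m zero) eq₁
    (suc i) → flatten-injective (d ∘ suc) (d≤m ∘ suc) eq₂ i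

  -- The given element of `A` fills the positions from `d` on.
  tabulate-inject≤-surjective : ∀ {d m} → A → (d≤m : d ≤ m) (w : Vec A d) →
    Σ (Fin m → A) λ y → Vec.tabulate (λ j → y (inject≤ j d≤m)) ≡ w
  tabulate-inject≤-surjective a z≤n [] = (λ _ → a) , refl
  tabulate-inject≤-surjective {suc d} {suc m} a (s≤s d≤m) (b ∷ w) with y , eq ← tabulate-inject≤-surjective a d≤m w =
    z , cong (b ∷_) eq
    where
    z : Fin (suc m) → A
    z zero    = b
    z (suc j) = y j

  flatten-surjective : ∀ {s m} → A → (d : Fin s → ℕ) (d≤m : ∀ i → d i ≤ m) (w : Vec A (Σℕ s d)) →
    Σ (Fin s → Fin m → A) λ y → flatten d d≤m y ≡ w
  flatten-surjective {zero} a d d≤m [] = (λ ()) , refl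
  flatten-surjective {suc s} a d d≤m w with Vec.splitAt (d zero) w
  ... | w₁ , w₂ , refl with y , eq ← tabulate-inject≤-surjective a (d≤m zero) w₁
                       with ys , eqs ← flatten-surjective a (d ∘ suc) (d≤m ∘ suc) w₂ =
    (λ { zero → y ; (suc i) → ys i }) , cong₂ _++_ eq eqs

  flatten-zipWith : ∀ {s m} (_∙_ : A → A → A) (d : Fin s → ℕ) (d≤m : ∀ i → d i ≤ m) (y z : Fin s → Fin m → A) →
    flatten d d≤m (λ i j → y i j ∙ z i j) ≡ Vec.zipWith _∙_ (flatten d d≤m y) (flatten d d≤m z)
  flatten-zipWith {zero} _∙_ d d≤m y z = refl
  flatten-zipWith {suc s} _∙_ d d≤m y z = trans
    (cong₂ _++_ (tabulate-zipWith _ _) (flatten-zipWith _∙_ (d ∘ suc) (d≤m ∘ suc) (y ∘ suc) (z ∘ suc)))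
    (sym (Vecₚ.zipWith-++ _∙_ (Vec.tabulate (λ j → y zero (inject≤ j (d≤m zero)))) _ (Vec.tabulate (λ j → z zero (inject≤ j (d≤m zero)))) _))
    where
    tabulate-zipWith : ∀ {n} (f g : Fin n → A) →
      Vec.tabulate (λ i → f i ∙ g i) ≡ Vec.zipWith _∙_ (Vec.tabulate f) (Vec.tabulate g)
    tabulate-zipWith {zero}  f g = refl
    tabulate-zipWith {suc n} f g = cong (f zero ∙ g zero ∷_) (tabulate-zipWith (f ∘ suc) (g ∘ suc))

-- Digital nets as linear systems

module FieldSums {Q : ℕ} (K : FiniteField Q) where
  open Field K
  open CMSum +-commutativeMonoid public using (sum; sum-cong-≗; ∑-distrib-+; ∑-comm)

  ΣF≡sum : ∀ m f → ΣF K m f ≡ sum f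
  ΣF≡sum zero    f = refl
  ΣF≡sum (suc m) f = cong (f zero +_) (ΣF≡sum m (f ∘ suc))

module LinearSystem {Q : ℕ} (K : FiniteField Q) {m s : ℕ} (C : Fin s → Fin m → Fin m → FiniteField.Carrier K) where
  open Field K
  open LinearFibres K
  open FieldSums K

  output : Vec Carrier m → Fin s → Fin m → Carrier
  output v i j = sum λ r → C i j r * Vec.lookup v r

  -- Equivalently, the first d i rows of all the matrices C i are linearly independent.
  Solvable : (Fin s → ℕ) → Set
  Solvable d = (z : Fin s → Fin m → Carrier) → Σ (Vec Carrier m) λ v → ∀ i j → toℕ j < d i → output v i j ≡ z i j

  output-+ : ∀ v u i j → output (v +ᵥ u) i j ≡ output v i j + output u i j
  output-+ v u i j = trans
    (sum-cong-≗ λ r → trans (cong (C i j r *_) (Vecₚ.lookup-zipWith _+_ r v u)) (distribˡ (C i j r) _ _))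
    (∑-distrib-+ (λ r → C i j r * Vec.lookup v r) (λ r → C i j r * Vec.lookup u r))

  open Flatten

  solution-card : ∀ d (d≤m : ∀ i → d i ≤ m) → Solvable d → ∀ z →
    Q ℕ.^ Σℕ s d ℕ.* sumV m (λ v → indicator (flatten d d≤m (output v) == z)) ≡ Q ℕ.^ m
  solution-card d d≤m solve = fibre-card (flatten d d≤m ∘ output)
    (λ v u → trans (flatten-cong d d≤m λ i j _ → output-+ v u i j) (flatten-zipWith _+_ d d≤m (output v) (output u)))
    λ w → let z , flat-z≡w = flatten-surjective 0# d d≤m w
              v , v-solves = solve z
          in v , trans (flatten-cong d d≤m v-solves) flat-z≡w

module DigitalNet {Q : ℕ} (K : FiniteField Q) {m s : ℕ} (D : DigitalNetData K m s) where
  open Field K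
  open LinearFibres K
  open DigitalNetData D
  open FieldSums K using (ΣF≡sum; sum-cong-≗)
  open LinearSystem K C public
  open Flatten

  instance
    Q≢0 : NonZero Q
    Q≢0 = ff-nonZero K

  input : ℕ → Vec Carrier m
  input = digitVec (⤖⇒↔ ∘ η)

  outputDigit : Vec Carrier m → Fin s → Fin m → Fin Q
  outputDigit v i j = Bijection.to (κ i j) (output v i j)

  pointNum≡value : ∀ n i → pointNum K D n i ≡ value Q m (outputDigit (input n) i)
  pointNum≡value n i = Σℕ-cong m λ j → cong (λ y → toℕ (Bijection.to (κ i j) y) ℕ.* Q ℕ.^ (m ∸ suc (toℕ j)))
    (trans (ΣF≡sum m _) (sum-cong-≗ λ r → cong (C i j r *_) (sym (Vecₚ.lookup∘tabulate _ r))))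

  module _ (u : ℕ) (e d : Fin s → ℕ) (d≤m : ∀ i → d i ≤ m) (x : Fin s → Fin m → Fin Q) where

    inBox′ : (a : Fin s → ℕ) → ℕ → Bool
    inBox′ = inBox Q u m s e (pointNum K D) d

    inBox⇒agree : ∀ {a} → (∀ i → prefix Q (d i) (x i) ≡ a i) → ∀ n → inBox′ a n ≡ true →
      ∀ i → Agree Q (d i) (outputDigit (input n) i) (x i)
    inBox⇒agree {a} prefix≡a n n∈box i = between⇒agree Q (d≤m i) _ (x i)
      (subst (λ b → Between Q m (d i) b (value Q m (outputDigit (input n) i))) (sym (prefix≡a i))
        (subst (Between Q m (d i) (a i)) (pointNum≡value n i)
          (inInterval⇒between Q m (d i) (a i) _
            (all⇒∀ s (trans (sym (inBox≡all Q u m s e (pointNum K D) d a n)) n∈box) i))))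

    agree⇒inBox : ∀ {a} → (∀ i → prefix Q (d i) (x i) ≡ a i) → ∀ n →
      (∀ i → Agree Q (d i) (outputDigit (input n) i) (x i)) → inBox′ a n ≡ true
    agree⇒inBox {a} prefix≡a n agree = trans (inBox≡all Q u m s e (pointNum K D) d a n)
      (∀⇒all s λ i → between⇒inInterval Q m (d i) (a i) _
        (subst (Between Q m (d i) (a i)) (sym (pointNum≡value n i))
          (subst (λ b → Between Q m (d i) b (value Q m (outputDigit (input n) i))) (prefix≡a i)
            (agree⇒between Q (d≤m i) _ (x i) (agree i)))))

  -- The interval whose leading digits are the images of `z` under `κ` contains a power of `Q`,
  -- hence at least one, of the points; its input solves the system because `κ` is injective.
  net⇒solvable : ∀ {u e} → IsNet Q u m s e (pointNum K D) →
    ∀ d → (∀ i → e i ∣ d i) → Σℕ s d ℕ.+ u ≤ m → Solvable d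
  net⇒solvable {u} {e} net d e∣d Σd+u≤m z =
    input n , λ i j j<d → Bijection.injective (κ i j)
      (inBox⇒agree u e d d≤m x (λ _ → refl) n n∈box i j j<d)
    where
    d≤m : ∀ i → d i ≤ m
    d≤m i = ℕₚ.≤-trans (term≤Σℕ s d i) (ℕₚ.≤-trans (ℕₚ.m≤m+n _ u) Σd+u≤m)
    x : Fin s → Fin m → Fin Q
    x i j = Bijection.to (κ i j) (z i j)
    a : Fin s → ℕ
    a i = prefix Q (d i) (x i)
    witness : Σ ℕ λ n → inBox Q u m s e (pointNum K D) d a n ≡ true
    witness = count>0⇒∃ (Q ℕ.^ m) _ (subst (0 <_)
      (sym (net-count Q u m s e _ net d a (λ i → prefix< Q (d i) (x i) (d≤m i)) e∣d Σd+u≤m))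
      (ℕₚ.m^n>0 Q (m ∸ Σℕ s d)))
    n : ℕ
    n = proj₁ witness
    n∈box : inBox Q u m s e (pointNum K D) d a n ≡ true
    n∈box = proj₂ witness

  solvable⇒count : ∀ u e d → Σℕ s d ≤ m → Solvable d → ∀ a → (∀ i → a i < Q ℕ.^ d i) →
    count (Q ℕ.^ m) (λ n → inBox Q u m s e (pointNum K D) d a n) ≡ Q ℕ.^ (m ∸ Σℕ s d)
  solvable⇒count u e d Σd≤m solve a a< = begin
    count (Q ℕ.^ m) (λ n → inBox Q u m s e (pointNum K D) d a n) ≡⟨ count-cong (Q ℕ.^ m) inBox≡== ⟩
    count (Q ℕ.^ m) ((λ v → flatten d d≤m (output v) == flatten d d≤m z) ∘ input) ≡⟨ count-digitVec (⤖⇒↔ ∘ η) _ ⟩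
    solutions ≡⟨ ℕₚ.*-cancelˡ-≡ solutions (Q ℕ.^ (m ∸ Σℕ s d)) (Q ℕ.^ Σℕ s d) {{ℕₚ.m^n≢0 Q (Σℕ s d)}} (begin
      Q ℕ.^ Σℕ s d ℕ.* solutions                  ≡⟨ solution-card d d≤m solve (flatten d d≤m z) ⟩
      Q ℕ.^ m                                     ≡⟨ cong (Q ℕ.^_) (ℕₚ.m+[n∸m]≡n Σd≤m) ⟨
      Q ℕ.^ (Σℕ s d ℕ.+ (m ∸ Σℕ s d))             ≡⟨ ℕₚ.^-distribˡ-+-* Q (Σℕ s d) (m ∸ Σℕ s d) ⟩
      Q ℕ.^ Σℕ s d ℕ.* Q ℕ.^ (m ∸ Σℕ s d)         ∎) ⟩
    Q ℕ.^ (m ∸ Σℕ s d) ∎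
    where
    open ≡-Reasoning
    d≤m : ∀ i → d i ≤ m
    d≤m i = ℕₚ.≤-trans (term≤Σℕ s d i) Σd≤m
    x : Fin s → Fin m → Fin Q
    x i = proj₁ (prefix-surjective Q (d i) (a i) (d≤m i) (a< i))
    prefix≡a : ∀ i → prefix Q (d i) (x i) ≡ a i
    prefix≡a i = proj₂ (prefix-surjective Q (d i) (a i) (d≤m i) (a< i))
    -- Every admissible `a` is the prefix of some digits `x`, and these are pulled back through `κ`
    -- to the outputs to be prescribed.
    z : Fin s → Fin m → Carrier
    z i j = Inverse.from (⤖⇒↔ (κ i j)) (x i j)
    solutions : ℕ
    solutions = sumV m (λ v → indicator (flatten d d≤m (output v) == flatten d d≤m z))
    inBox≡== : ∀ n → inBox Q u m s e (pointNum K D) d a n ≡ (flatten d d≤m (output (input n)) == flatten d d≤m z)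
    inBox≡== n = bool-ext
      (λ n∈box → trans (cong (_== flatten d d≤m z) (flatten-cong d d≤m λ i j j<d →
          trans (sym (Inverse.strictlyInverseʳ (⤖⇒↔ (κ i j)) _))
            (cong (Inverse.from (⤖⇒↔ (κ i j))) (inBox⇒agree u e d d≤m x prefix≡a n n∈box i j j<d))))
        (==-refl (flatten d d≤m z)))
      (λ eq → agree⇒inBox u e d d≤m x prefix≡a n λ i j j<d →
          trans (cong (Bijection.to (κ i j)) (flatten-injective d d≤m (==⇒≡ _ _ eq) i j j<d))
            (Inverse.strictlyInverseˡ (⤖⇒↔ (κ i j)) (x i j)))

-- Restriction of scalars

open import Data.Nat using (_+_; _*_; _^_)

module _ {c ℓ} (M : CommutativeMonoid c ℓ) where
  open CommutativeMonoid M renaming (refl to ≈-refl; sym to ≈-sym; trans to ≈-trans)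
  open CMSum M

  sum-splitAt : ∀ m {n} (f : Fin (m + n) → Carrier) → sum f ≈ sum (f ∘ (_↑ˡ n)) ∙ sum (f ∘ (m ↑ʳ_))
  sum-splitAt zero    f = ≈-sym (identityˡ _)
  sum-splitAt (suc m) f = ≈-trans (∙-congˡ (sum-splitAt m (f ∘ suc))) (≈-sym (assoc _ _ _))

  sum-combine : ∀ m n (f : Fin (m * n) → Carrier) → sum f ≈ sum {m} (λ i → sum {n} (λ j → f (combine i j)))
  sum-combine zero    n f = ≈-refl
  sum-combine (suc m) n f = ≈-trans (sum-splitAt n f) (∙-congˡ (sum-combine m n (f ∘ (n ↑ʳ_))))

maximum : ∀ n → (Fin n → ℕ) → ℕ
maximum zero    f = 0
maximum (suc n) f = f zero ⊔ maximum n (f ∘ suc)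

≤maximum : ∀ n f i → f i ≤ maximum n f
≤maximum (suc n) f zero    = ℕₚ.m≤m⊔n _ _
≤maximum (suc n) f (suc i) = ℕₚ.≤-trans (≤maximum n (f ∘ suc) i) (ℕₚ.m≤n⊔m _ _)

maximum≤Σℕ : ∀ n f → maximum n f ≤ Σℕ n f
maximum≤Σℕ zero    f = z≤n
maximum≤Σℕ (suc n) f = ℕₚ.⊔-lub (ℕₚ.m≤m+n _ _) (ℕₚ.≤-trans (maximum≤Σℕ n (f ∘ suc)) (ℕₚ.m≤n+m _ _))

-- A maximum is one of its terms or the default 0, and both are multiples of `e`. Hence the depths
-- D_i meet the divisibility condition of the given net.
∣maximum : ∀ {e} n f → (∀ i → e ∣ f i) → e ∣ maximum n f
∣maximum zero    f e∣f = _ ∣0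
∣maximum (suc n) f e∣f with ℕₚ.⊔-sel (f zero) (maximum n (f ∘ suc))
... | inj₁ eq = subst (_ ∣_) (sym eq) (e∣f zero)
... | inj₂ eq = subst (_ ∣_) (sym eq) (∣maximum n (f ∘ suc) (e∣f ∘ suc))

Σℕ-mono : ∀ s {f g : Fin s → ℕ} → (∀ i → f i ≤ g i) → Σℕ s f ≤ Σℕ s g
Σℕ-mono zero    f≤g = z≤n
Σℕ-mono (suc s) f≤g = ℕₚ.+-mono-≤ (f≤g zero) (Σℕ-mono s (f≤g ∘ suc))

Σℕ-combine : ∀ s r (d : Fin (s * r) → ℕ) → Σℕ s (λ i → Σℕ r (λ h → d (combine i h))) ≡ Σℕ (s * r) d
Σℕ-combine s r d = begin
  Σℕ s (λ i → Σℕ r (λ h → d (combine i h)))   ≡⟨ Σℕ-cong s (λ i → Σℕ≡sum r _) ⟩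
  Σℕ s (λ i → sum {r} (λ h → d (combine i h))) ≡⟨ Σℕ≡sum s _ ⟩
  sum {s} (λ i → sum {r} (λ h → d (combine i h))) ≡⟨ sum-combine ℕₚ.+-0-commutativeMonoid s r d ⟨
  sum d                                       ≡⟨ Σℕ≡sum (s * r) d ⟨
  Σℕ (s * r) d                                ∎
  where
  open ≡-Reasoning
  open CMSum ℕₚ.+-0-commutativeMonoid using (sum)
  Σℕ≡sum : ∀ n f → Σℕ n f ≡ sum f
  Σℕ≡sum zero    f = refl
  Σℕ≡sum (suc n) f = cong (f zero +_) (Σℕ≡sum n (f ∘ suc))

module Coordinates {q Q r : ℕ} (F : FiniteField q) (K : FiniteField Q)
  (φ : FiniteField.Carrier F → FiniteField.Carrier K) (φ-hom : IsFieldHom F K φ) where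
  module F = Field F
  module K = Field K
  module ΣF′ = FieldSums F
  module ΣK = FieldSums K
  open Extension F K φ φ-hom public

  lin≡sum : ∀ {n} (ω : Vec K.Carrier n) w → lin ω w ≡ ΣK.sum (λ t → φ (Vec.lookup w t) K.* Vec.lookup ω t)
  lin≡sum [] [] = refl
  lin≡sum (x ∷ ω) (c ∷ w) = cong (φ c K.* x K.+_) (lin≡sum ω w)

  module _ (ω : Vec K.Carrier r) (independent : Independent ω) (spanning : Spanning ω) where

    coord : Fin r → K.Carrier → F.Carrier
    coord h x = Vec.lookup (proj₁ (spanning x)) h

    coord-lin : ∀ h w → coord h (lin ω w) ≡ Vec.lookup w h
    coord-lin h w = cong (λ w → Vec.lookup w h) (independent _ _ (proj₂ (spanning (lin ω w))))

    coord-+ : ∀ h x y → coord h (x K.+ y) ≡ coord h x F.+ coord h y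
    coord-+ h x y = trans
      (cong (λ w → Vec.lookup w h) (independent _ _ (trans (proj₂ (spanning (x K.+ y)))
        (sym (trans (lin-+ ω _ _) (cong₂ K._+_ (proj₂ (spanning x)) (proj₂ (spanning y))))))))
      (Vecₚ.lookup-zipWith F._+_ h (proj₁ (spanning x)) (proj₁ (spanning y)))

    coord-* : ∀ h c x → coord h (φ c K.* x) ≡ c F.* coord h x
    coord-* h c x = trans
      (cong (λ w → Vec.lookup w h) (independent _ _ (trans (proj₂ (spanning (φ c K.* x)))
        (sym (trans (lin-* ω c _) (cong (φ c K.*_) (proj₂ (spanning x))))))))
      (Vecₚ.lookup-map h (c F.*_) (proj₁ (spanning x)))

    coord-0 : ∀ h → coord h K.0# ≡ F.0#
    coord-0 h = trans (cong (coord h) (sym (K.zeroʳ (φ F.0#)))) (trans (coord-* h F.0# K.0#) (F.zeroˡ _))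

    coord-sum : ∀ h {n} (f : Fin n → K.Carrier) → coord h (ΣK.sum f) ≡ ΣF′.sum (coord h ∘ f)
    coord-sum h {zero}  f = coord-0 h
    coord-sum h {suc n} f = trans (coord-+ h _ _) (cong (coord h (f zero) F.+_) (coord-sum h (f ∘ suc)))

    sum-coord : ∀ x → ΣK.sum (λ t → φ (coord t x) K.* Vec.lookup ω t) ≡ x
    sum-coord x = trans (sym (lin≡sum ω _)) (proj₂ (spanning x))

    module Restriction {m s : ℕ} (C : Fin s → Fin m → Fin m → K.Carrier) where

      -- For fixed `i`, `j`, `l` this is the matrix, in the basis `ω`, of multiplication by
      -- `C i j l` on `K` over `F`, with row `h` and column `t`.
      entry : Fin s → Fin r → Fin m → Fin r → Fin m → F.Carrier
      entry i h j t l = coord h (C i j l K.* Vec.lookup ω t)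

      -- Row j of the matrix with index (i , h) is the functional v ↦ coord h ⟨C i j , v⟩ on Kᵐ,
      -- where Kᵐ is identified with Fʳᵐ through the coordinates; the rows from m on are never used.
      row : Fin (s * r) → ∀ {J : Fin (r * m)} → Dec (toℕ J < m) → Fin (r * m) → F.Carrier
      row k (yes J<m) R = entry (quotient r k) (remainder {s} r k) (fromℕ< J<m) (quotient m R) (remainder {r} m R)
      row k (no _)    R = F.0#

      restricted : Fin (s * r) → Fin (r * m) → Fin (r * m) → F.Carrier
      restricted k J = row k {J} (toℕ J ℕ.<? m)

      module Source = LinearSystem K C
      module Target = LinearSystem F restricted

      restrictVec : Vec K.Carrier m → Vec F.Carrier (r * m)
      restrictVec v = Vec.tabulate λ R → coord (quotient m R) (Vec.lookup v (remainder {r} m R))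

      sum-entry : ∀ v i h j →
        ΣF′.sum (λ t → ΣF′.sum (λ l → entry i h j t l F.* coord t (Vec.lookup v l))) ≡ coord h (Source.output v i j)
      sum-entry v i h j = begin
        ΣF′.sum (λ t → ΣF′.sum (λ l → entry i h j t l F.* coord t (Vec.lookup v l)))
          ≡⟨ ΣF′.∑-comm {r} {m} (λ t l → entry i h j t l F.* coord t (Vec.lookup v l)) ⟩
        ΣF′.sum (λ l → ΣF′.sum (λ t → entry i h j t l F.* coord t (Vec.lookup v l)))
          ≡⟨ ΣF′.sum-cong-≗ (λ l → column l) ⟩
        ΣF′.sum (λ l → coord h (C i j l K.* Vec.lookup v l))
          ≡⟨ coord-sum h (λ l → C i j l K.* Vec.lookup v l) ⟨
        coord h (Source.output v i j) ∎
        where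
        open ≡-Reasoning
        module _ (l : Fin m) where
          c x : K.Carrier
          c = C i j l
          x = Vec.lookup v l
          -- Expand `x` in the basis `ω` and use that `coord h` is F-linear.
          column : ΣF′.sum (λ t → entry i h j t l F.* coord t x) ≡ coord h (c K.* x)
          column = begin
            ΣF′.sum (λ t → entry i h j t l F.* coord t x)
              ≡⟨ ΣF′.sum-cong-≗ (λ t → trans (F.*-comm _ _) (sym (coord-* h (coord t x) _))) ⟩
            ΣF′.sum (λ t → coord h (φ (coord t x) K.* (c K.* Vec.lookup ω t)))
              ≡⟨ coord-sum h (λ t → φ (coord t x) K.* (c K.* Vec.lookup ω t)) ⟨
            coord h (ΣK.sum (λ t → φ (coord t x) K.* (c K.* Vec.lookup ω t)))
              ≡⟨ cong (coord h) (ΣK.sum-cong-≗ λ t → K.*-swap (φ (coord t x)) c (Vec.lookup ω t)) ⟩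
            coord h (ΣK.sum (λ t → c K.* (φ (coord t x) K.* Vec.lookup ω t)))
              ≡⟨ cong (coord h) (SemiringSum.*-distribˡ-sum K.semiring c (λ t → φ (coord t x) K.* Vec.lookup ω t)) ⟨
            coord h (c K.* ΣK.sum (λ t → φ (coord t x) K.* Vec.lookup ω t))
              ≡⟨ cong (λ y → coord h (c K.* y)) (sum-coord x) ⟩
            coord h (c K.* x) ∎

      sum-row : ∀ v k {J} (J<m : toℕ J < m) →
        ΣF′.sum (λ R → row k {J} (yes J<m) R F.* Vec.lookup (restrictVec v) R)
          ≡ coord (remainder {s} r k) (Source.output v (quotient r k) (fromℕ< J<m))
      sum-row v k {J} J<m = begin
        ΣF′.sum (λ R → row k {J} (yes J<m) R F.* Vec.lookup (restrictVec v) R)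
          ≡⟨ ΣF′.sum-cong-≗ {r * m} (λ R → cong (row k {J} (yes J<m) R F.*_) (Vecₚ.lookup∘tabulate _ R)) ⟩
        ΣF′.sum {r * m} (λ R → term (Fin.remQuot {r} m R))
          ≡⟨ sum-combine F.+-commutativeMonoid r m (λ R → term (Fin.remQuot {r} m R)) ⟩
        ΣF′.sum {r} (λ t → ΣF′.sum {m} (λ l → term (Fin.remQuot {r} m (combine t l))))
          ≡⟨ ΣF′.sum-cong-≗ {r} (λ t → ΣF′.sum-cong-≗ {m} λ l → cong term (Finₚ.remQuot-combine {r} {m} t l)) ⟩
        ΣF′.sum (λ t → ΣF′.sum (λ l → term (t , l)))
          ≡⟨ sum-entry v (quotient r k) (remainder {s} r k) (fromℕ< J<m) ⟩
        coord (remainder {s} r k) (Source.output v (quotient r k) (fromℕ< J<m)) ∎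
        where
        open ≡-Reasoning
        term : Fin r × Fin m → F.Carrier
        term (t , l) = entry (quotient r k) (remainder {s} r k) (fromℕ< J<m) t l F.* coord t (Vec.lookup v l)

      solvable : (d : Fin (s * r) → ℕ) → (∀ k → d k ≤ m) → (m≤rm : m ≤ r * m) →
        Source.Solvable (λ i → maximum r (λ h → d (combine i h))) → Target.Solvable d
      solvable d d≤m m≤rm solve z = restrictVec v , λ k J J<d → go k J (toℕ J ℕ.<? m) J<d
        where
        -- The `r` values prescribed over `F` at level `j` are the coordinates of one element of
        -- `K`. Levels between some `d (combine i h)` and the maximum prescribe more than is asked,
        -- which is harmless.
        target : Fin s → Fin m → Vec F.Carrier r
        target i j = Vec.tabulate λ h → z (combine i h) (inject≤ j m≤rm)
        solution : Σ (Vec K.Carrier m) λ v → ∀ i j → toℕ j < maximum r (λ h → d (combine i h)) →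
          Source.output v i j ≡ lin ω (target i j)
        solution = solve λ i j → lin ω (target i j)
        v : Vec K.Carrier m
        v = proj₁ solution
        go : ∀ k J (J<m? : Dec (toℕ J < m)) → toℕ J < d k →
          ΣF′.sum (λ R → row k {J} J<m? R F.* Vec.lookup (restrictVec v) R) ≡ z k J
        go k J (no J≮m) J<d = contradiction (ℕₚ.<-≤-trans J<d (d≤m k)) J≮m
        go k J (yes J<m) J<d = begin
          ΣF′.sum (λ R → row k {J} (yes J<m) R F.* Vec.lookup (restrictVec v) R) ≡⟨ sum-row v k J<m ⟩
          coord h (Source.output v i j)        ≡⟨ cong (coord h) (proj₂ solution i j j<max) ⟩
          coord h (lin ω (target i j))         ≡⟨ coord-lin h (target i j) ⟩
          Vec.lookup (target i j) h            ≡⟨ Vecₚ.lookup∘tabulate _ h ⟩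
          z (combine i h) (inject≤ j m≤rm)     ≡⟨ cong₂ z (Finₚ.combine-remQuot {s} r k) inject≡J ⟩
          z k J                                ∎
          where
          open ≡-Reasoning
          i : Fin s
          i = quotient r k
          h : Fin r
          h = remainder {s} r k
          j : Fin m
          j = fromℕ< J<m
          inject≡J : inject≤ j m≤rm ≡ J
          inject≡J = Finₚ.toℕ-injective (trans (Finₚ.toℕ-inject≤ j m≤rm) (Finₚ.toℕ-fromℕ< J<m))
          j<max : toℕ j < maximum r (λ h → d (combine i h))
          j<max = ℕₚ.<-≤-trans
            (subst (_< d (combine i h)) (sym (Finₚ.toℕ-fromℕ< J<m))
              (subst (λ k → toℕ J < d k) (sym (Finₚ.combine-remQuot {s} r k)) J<d))
            (≤maximum r (λ h → d (combine i h)) h)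

theorem2 : (q m s u r : ℕ) → IsPrimePower q → 1 ≤ m → 1 ≤ s → 1 ≤ r →
    (e : Fin s → ℕ) → (∀ i → 1 ≤ e i) →
    (K : FiniteField (q ^ r)) → (F : FiniteField q) →
    DigitalNetExists K u m e →
    DigitalNetExists F ((r ∸ 1) * m + u) (r * m) (repeatEach r e)
theorem2 q m s u r@(suc r-1) q-primePower _ _ _ e _ K F (D , net@(u≤m , _))
  with φ , φ-hom ← subfield {r = r} q-primePower F K
  with ω , independent , spanning ← Extension.basis F K φ φ-hom {r} refl =
  D′ , subst (r-1 * m + u ≤_) (ℕₚ.+-comm (r-1 * m) m) (ℕₚ.+-monoʳ-≤ (r-1 * m) u≤m) , λ d a a< e∣d Σd≤ →
    DigitalNet.solvable⇒count F D′ (r-1 * m + u) (repeatEach r e) d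
      (ℕₚ.≤-trans (ℕₚ.m≤m+n _ _) Σd≤) (restricted-solvable d e∣d (cancel (Σℕ (s * r) d) Σd≤)) a a<
  where
  open Coordinates F K φ φ-hom
  open Restriction ω independent spanning (DigitalNetData.C D) using (restricted; solvable; module Target)

  D′ : DigitalNetData F (r * m) (s * r)
  -- The count holds for all digit bijections, so the enumeration of `F` and its inverse serve
  -- everywhere.
  D′ = record { C = restricted ; η = λ _ → F.card ; κ = λ _ _ → sym-≡ F.card }

  -- `r * m` unfolds to `m + r-1 * m`, so the summand `r-1 * m` of the new parameter cancels and the
  -- condition for the given net remains.
  cancel : ∀ a → a + (r-1 * m + u) ≤ m + r-1 * m → a + u ≤ m
  cancel a le = ℕₚ.+-cancelʳ-≤ (r-1 * m) (a + u) m (subst (_≤ m + r-1 * m)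
    (trans (cong (a +_) (ℕₚ.+-comm (r-1 * m) u)) (sym (ℕₚ.+-assoc a u (r-1 * m)))) le)

  restricted-solvable : ∀ d → (∀ k → repeatEach r e k ∣ d k) → Σℕ (s * r) d + u ≤ m → Target.Solvable d
  restricted-solvable d e∣d Σd+u≤m = solvable d
    (λ k → ℕₚ.≤-trans (term≤Σℕ (s * r) d k) (ℕₚ.≤-trans (ℕₚ.m≤m+n _ u) Σd+u≤m))
    (ℕₚ.m≤m+n m (r-1 * m))
    (DigitalNet.net⇒solvable K D net (λ i → maximum r (λ h → d (combine i h)))
      (λ i → ∣maximum r (λ h → d (combine i h)) λ h →
        subst (λ i′ → e i′ ∣ d (combine i h)) (cong proj₁ (Finₚ.remQuot-combine {n = s} {k = r} i h)) (e∣d (combine i h)))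
      (ℕₚ.≤-trans (ℕₚ.+-monoˡ-≤ u (ℕₚ.≤-trans
        (Σℕ-mono s (λ i → maximum≤Σℕ r (λ h → d (combine i h))))
        (ℕₚ.≤-reflexive (Σℕ-combine s r d)))) Σd+u≤m))
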